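{- Let $p$ be a prime and let $V\subseteq W^{*}$ be the span of the linear functionals $R_{x,y,z}$ for all $x,y,z\in\mathbb{Z}/p\mathbb{Z}$ with $xyz\neq0$, where \[ R_{x,y,z}(f)=f(1:x:y)+f(1:y:z)+f(1:z:x)-f\!\left(1:\tfrac{y}{x}:\tfrac{z}{x}\right). \] Then $V$ equals the annihilator of $W^{\mathrm{nc}}$ in the dual space $W^{*}$ of $W$.
   Context: Let $p$ be a prime. $W$ denotes the complex vector space of functions $f\colon\mathbb{P}^2(\mathbb{Z}/p\mathbb{Z})\to\mathbb{C}$ satisfying (i) $f(x:y:z)=f(z:x:y)=f(-x:y:z)=-f(y:x:z)$ and (ii) $f(x:y:z)+f(-y:x-y:z)+f(y-x:-x:z)=0$ for all points. $W_0$ denotes the complex vector space of functions $f\colon\mathbb{P}^1(\mathbb{Z}/p\mathbb{Z})\to\mathbb{C}$ satisfying (i) $f(x:y)=f(-x:y)=-f(y:x)$, (ii) $f(x:y)+f(-y:x-y)+f(y-x:-x)=0$, (iii) $f(1:0)=0$. For $f\in W_0$ set $f(0:0)=0$, and define linear maps $\alpha,\beta\colon W_0\to W$ by $(\alpha f)(x:y:z)=f(x:y)+f(y:z)+f(z:x)$, and $(\beta f)(x:y:z)=0$ if $xyz\neq0$, $=f(x:y)$ if $z=0$, $=f(y:z)$ if $x=0$, $=f(z:x)$ if $y=0$. Define $W^{\mathrm{nc}}=\alpha(W_0)+\beta(W_0)\subseteq W$. $W^{*}$ denotes the space of $\mathbb{C}$-linear functionals on $W$. -}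

module Defs where

open import Level using (Level; _⊔_) renaming (suc to lsuc)
open import Data.Nat as ℕ using (ℕ; NonZero)
open import Data.Nat.DivMod using (_mod_)
open import Data.Fin as Fin using (Fin; toℕ)
open import Data.Bool using (Bool; true; false; if_then_else_; _∧_; not)
open import Data.Product using (Σ; _×_; _,_)
open import Relation.Nullary using (¬_)
open import Relation.Nullary.Decidable using (⌊_⌋)
open import Relation.Binary.PropositionalEquality using (_≢_)
open import Algebra.Bundles using (CommutativeRing)

record Field (c ℓ : Level) : Set (lsuc (c ⊔ ℓ)) where
  field
    commutativeRing : CommutativeRing c ℓ
  open CommutativeRing commutativeRing public
  field
    0≉1     : ¬ (0# ≈ 1#)
    inverse : ∀ x → ¬ (x ≈ 0#) → Σ Carrier λ y → (x * y) ≈ 1#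

module _ {c ℓ : Level} (K : Field c ℓ) where
  open Field K

  natToK : ℕ → Carrier
  natToK ℕ.zero    = 0#
  natToK (ℕ.suc n) = 1# + natToK n

  CharZero : Set ℓ
  CharZero = ∀ n → ¬ (natToK (ℕ.suc n) ≈ 0#)

module _ (p : ℕ) .{{_ : NonZero p}} where

  Zp : Set
  Zp = Fin p

  0F 1F : Zp
  0F = 0 mod p
  1F = 1 mod p

  _+F_ _*F_ _-F_ _/F_ : Zp → Zp → Zp
  a +F b = (toℕ a ℕ.+ toℕ b) mod p
  a *F b = (toℕ a ℕ.* toℕ b) mod p

  negF : Zp → Zp
  negF a = (p ℕ.∸ toℕ a) mod p

  a -F b = a +F (negF b)

  -- multiplicative inverse via Fermat: a⁻¹ = a^(p-2) (p prime, a ≠ 0)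
  invF : Zp → Zp
  invF a = (toℕ a ℕ.^ (p ℕ.∸ 2)) mod p

  b /F a = b *F invF a

  isZero : Zp → Bool
  isZero a = ⌊ a Fin.≟ 0F ⌋

  nonZero : Zp → Bool
  nonZero a = not (isZero a)

-- Functions on P²(ℤ/p) and P¹(ℤ/p) with values in a field K, represented
-- as functions on triples/pairs that are invariant under nonzero scaling
-- and vanish at the zero vector (which is not a projective point).

module _ {c ℓ : Level} (K : Field c ℓ) (p : ℕ) .{{_ : NonZero p}} where
  open Field K

  Fn3 : Set c
  Fn3 = Zp p → Zp p → Zp p → Carrier

  Fn2 : Set c
  Fn2 = Zp p → Zp p → Carrier

  private
    _⊕_ = _+F_ p
    _⊗_ = _*F_ p
    _⊖_ = _-F_ p
    ⊝_ = negF p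
    z = 0F p
    o = 1F p

  IsFnP2 : Fn3 → Set (ℓ)
  IsFnP2 f = (f z z z ≈ 0#)
           × (∀ t x y w → t ≢ z → f (t ⊗ x) (t ⊗ y) (t ⊗ w) ≈ f x y w)

  IsW : Fn3 → Set ℓ
  IsW f = IsFnP2 f
        × (∀ x y w → f x y w ≈ f w x y)
        × (∀ x y w → f x y w ≈ f (⊝ x) y w)
        × (∀ x y w → f x y w ≈ - f y x w)
        × (∀ x y w → (f x y w + f (⊝ y) (x ⊖ y) w + f (y ⊖ x) (⊝ x) w) ≈ 0#)

  IsFnP1 : Fn2 → Set ℓ
  IsFnP1 f = (f z z ≈ 0#)
           × (∀ t x y → t ≢ z → f (t ⊗ x) (t ⊗ y) ≈ f x y)

  IsW0 : Fn2 → Set ℓ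
  IsW0 f = IsFnP1 f
         × (∀ x y → f x y ≈ f (⊝ x) y)
         × (∀ x y → f x y ≈ - f y x)
         × (∀ x y → (f x y + f (⊝ y) (x ⊖ y) + f (y ⊖ x) (⊝ x)) ≈ 0#)
         × (f o z ≈ 0#)

  α : Fn2 → Fn3
  α f x y w = f x y + f y w + f w x

  β : Fn2 → Fn3
  β f x y w =
    if nonZero p x ∧ nonZero p y ∧ nonZero p w then 0#
    else if isZero p w then f x y
    else if isZero p x then f y w
    else f w x

  InWnc : Fn3 → Set (c ⊔ ℓ)
  InWnc g = Σ Fn2 λ f₁ → Σ Fn2 λ f₂ → IsW0 f₁ × IsW0 f₂
          × (∀ x y w → g x y w ≈ (α f₁ x y w + β f₂ x y w))

  _+₃_ : Fn3 → Fn3 → Fn3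
  (f +₃ g) x y w = f x y w + g x y w

  _·₃_ : Carrier → Fn3 → Fn3
  (a ·₃ f) x y w = a * f x y w

  record Functional : Set (c ⊔ ℓ) where
    field
      φ        : (f : Fn3) → IsW f → Carrier
      φ-cong   : ∀ f g (pf : IsW f) (pg : IsW g) →
                 (∀ x y w → f x y w ≈ g x y w) → φ f pf ≈ φ g pg
      φ-add    : ∀ f g (pf : IsW f) (pg : IsW g) (pfg : IsW (f +₃ g)) →
                 φ (f +₃ g) pfg ≈ (φ f pf + φ g pg)
      φ-scale  : ∀ a f (pf : IsW f) (paf : IsW (a ·₃ f)) →
                 φ (a ·₃ f) paf ≈ (a * φ f pf)
  open Functional public

  R : Zp p → Zp p → Zp p → Fn3 → Carrier
  R x y w f = f o x y + f o y w + f o w x - f o (_/F_ p y x) (_/F_ p w x)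

  sumZp : (Zp p → Carrier) → Carrier
  sumZp h = go p (λ i → h (i mod p))
    where
    go : ℕ → (ℕ → Carrier) → Carrier
    go ℕ.zero    _ = 0#
    go (ℕ.suc n) k = k n + go n k

  InV : Functional → Set (c ⊔ ℓ)
  InV Φ = Σ (Zp p → Zp p → Zp p → Carrier) λ coef →
    ∀ f (pf : IsW f) →
      φ Φ f pf ≈ sumZp (λ x → sumZp (λ y → sumZp (λ w →
        if nonZero p x ∧ nonZero p y ∧ nonZero p w
        then coef x y w * R x y w f else 0#)))

  InAnn : Functional → Set (c ⊔ ℓ)
  InAnn Φ = ∀ g (pg : IsW g) → InWnc g → φ Φ g pg ≈ 0#

{-# OPTIONS --safe #-}

-- A function in W is determined by its values F x y w at xyw ≠ 0 and by its restriction to the line w = 0.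
-- The relations R = 0 say that F is a homogeneous cocycle on (ℤ/p)ˣ; averaging F v x y over v ≠ 0 gives
-- f₁ ∈ W₀ with F = α f₁ there, and what remains of f is β of the restriction minus f₁.  So Wⁿᶜ is the
-- common kernel of the R's in W.  A functional vanishing on it lies in the span of the R's by linear
-- algebra, which is constructive because all the equations involved have integer coefficients.
module Submission where

open import Defs
open import Level using (Level; 0ℓ; _⊔_)
open import Data.Bool using (true; false; if_then_else_; _∧_)
open import Data.Empty using (⊥-elim)
open import Data.Fin using (Fin; toℕ; fromℕ; inject₁; _≟_) renaming (zero to fzero; suc to fsuc)
open import Data.Fin.Permutation using (Permutation′; permutation)
open import Data.Fin.Properties using (any?; toℕ-injective; toℕ-fromℕ<; toℕ<n; toℕ-fromℕ; toℕ-inject₁)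
open import Data.Maybe using (just; nothing)
open import Data.Nat as ℕ using (ℕ; zero; suc; NonZero)
open import Data.Nat.Coprimality using (coprime-Bézout; prime⇒coprime)
open import Data.Nat.DivMod
  using (_mod_; m%n<n; m<n⇒m%n≡m; m%n%n≡m%n; %-congˡ; %-distribˡ-+; %-distribˡ-*; [m+n]%n≡m%n; [m+kn]%n≡m%n)
open import Data.Nat.GCD using (module Bézout)
open import Data.Nat.Primality using (Prime; prime⇒nonZero; ¬prime[0]; ¬prime[1])
import Data.Nat.Properties as ℕₚ
open import Data.Nat.Solver using (module +-*-Solver)
open import Data.Product using (Σ; _×_; _,_; proj₁; proj₂)
open import Data.Unit.Polymorphic using (⊤; tt)
open import Relation.Nullary using (¬_; Dec; yes; no)
open import Relation.Nullary.Decidable using (¬?; decidable-stable)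
open import Relation.Binary.Definitions using (WeaklyDecidable)
open import Relation.Binary.PropositionalEquality as ≡ using (_≡_; _≢_)
open import Algebra.Bundles using (CommutativeMonoid; RawRing)

-- For a fixed v, for instance v = 1, the function `f v x y` is already a primitive of the cocycle,
-- but it is not invariant under scaling of (x , y). The mean over all v ≠ 0 is invariant, and it
-- inherits the linear relations of W because they hold for each v. It needs 1/(p-1), available in
-- characteristic zero.
--
-- In the duality step, a `Functional` lives only on W and equality in `K` is undecidable, so there
-- is no choosing a basis or a complement. The substitute is an operator P with a nonzero factor c:
-- it maps every function into the solution space of the given equations, and Ψ ∘ P - c Ψ is a
-- consequence of those equations for every linear form Ψ. With the equations of W this gives `P₀`,
-- and Φ ∘ `P₀` is a form on all functions that equals `c₀` Φ on W. With the R's added it gives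
-- `P₁`, whose image lies in Wⁿᶜ. If Φ kills Wⁿᶜ, then Φ ∘ `P₀` ∘ `P₁` = 0, so -`c₁` `c₀` Φ is a
-- combination of the R's on W. Dividing by `c₁` `c₀` is left to the end, which keeps the
-- elimination within the integers.

toℕ-mod : ∀ m n .{{_ : NonZero n}} → toℕ (m mod n) ≡ m ℕ.% n
toℕ-mod m n = toℕ-fromℕ< (m%n<n m n)

mod-toℕ : ∀ {n} .{{_ : NonZero n}} (i : Fin n) → toℕ i mod n ≡ i
mod-toℕ {n} i = toℕ-injective (≡.trans (toℕ-mod (toℕ i) n) (m<n⇒m%n≡m (toℕ<n i)))

-- Finite sums over residues

module Sums {c ℓ} (K : Field c ℓ) where
  open Field K using (Carrier; _≈_; _+_; 0#; refl; trans; sym; setoid; +-cong; +-congˡ; +-comm; reflexive; semiring)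
  open import Algebra.Properties.Semiring.Sum semiring

  sum< : ℕ → (ℕ → Carrier) → Carrier
  sum< zero    k = 0#
  sum< (suc n) k = k n + sum< n k

  sum<-unique : (k G : ℕ → Carrier) → G 0 ≡ 0# → (∀ n → G (suc n) ≡ k n + G n) → ∀ n → G n ≡ sum< n k
  sum<-unique k G G0 G+ zero    = G0
  sum<-unique k G G0 G+ (suc n) = ≡.trans (G+ n) (≡.cong (k n +_) (sum<-unique k G G0 G+ n))

  -- The local function of sumZp cannot be named here; partialSum is unified with it in sumZp≡sum<.
  mutual
    partialSum : ∀ q .{{_ : NonZero q}} → (Zp q → Carrier) → (ℕ → Carrier) → ℕ → Carrier
    partialSum q h k n = _

    sumZp≡sum< : ∀ q .{{_ : NonZero q}} (h : Zp q → Carrier) → sumZp K q h ≡ sum< q (λ i → h (i mod q))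
    sumZp≡sum< q h with (λ (i : ℕ) → h (i mod q))
    sumZp≡sum< (suc m) h | k with suc m
    -- After one unfolding, abstracting `suc m` makes the modulus a variable independent of the
    -- counter `m`, so the unknown in `partialSum` is applied to distinct variables and unification
    -- determines it.
    ... | q = ≡.cong (k m +_) (sum<-unique k (partialSum q h k) ≡.refl (λ _ → ≡.refl) m)

  sum<≈sum : ∀ n (k : ℕ → Carrier) → sum< n k ≈ sum {n} (λ i → k (toℕ i))
  sum<≈sum zero    k = refl
  sum<≈sum (suc n) k = begin
    k n + sum< n k                                     ≈⟨ +-comm _ _ ⟩
    sum< n k + k n                                     ≈⟨ +-cong (sum<≈sum n k) refl ⟩
    sum {n} (λ i → k (toℕ i)) + k n                    ≡⟨ ≡.cong₂ _+_ (sum-cong-≗ {n} λ i → ≡.cong k (toℕ-inject₁ i))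
                                                                     (≡.cong k (toℕ-fromℕ n)) ⟨
    sum {n} (λ i → k (toℕ (inject₁ i))) + k (toℕ (fromℕ n)) ≈⟨ sym (sum-init-last {n} (λ i → k (toℕ i))) ⟩
    sum {suc n} (λ i → k (toℕ i))                      ∎
    where open import Relation.Binary.Reasoning.Setoid setoid

  sum-zero : ∀ {n} (a : Fin n → Carrier) → (∀ i → a i ≈ 0#) → sum a ≈ 0#
  sum-zero {n} a a≈0 = trans (sum-cong-≋ a≈0) (sum-replicate-zero n)

  sumZp≈sum : ∀ q .{{_ : NonZero q}} (h : Zp q → Carrier) → sumZp K q h ≈ sum h
  sumZp≈sum q h = trans (reflexive (sumZp≡sum< q h))
    (trans (sum<≈sum q _) (reflexive (sum-cong-≗ {q} λ i → ≡.cong h (mod-toℕ i))))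

-- The integers inside a field of characteristic zero

module Integers {c ℓ} (K : Field c ℓ) where
  open Field K
  open import Algebra.Properties.Ring ring
    using (-‿distribˡ-*; -‿distribʳ-*; -‿involutive; -0#≈0#; -‿+-comm; +-cancelˡ)
    renaming (x∙y⁻¹≈ε⇒x≈y to x-y≈0⇒x≈y)
  open import Algebra.Properties.CommutativeSemigroup +-commutativeSemigroup using (interchange)
  open import Relation.Binary.Reasoning.Setoid setoid

  ι : ℕ → Carrier
  ι = natToK K

  ι-+ : ∀ m n → ι (m ℕ.+ n) ≈ ι m + ι n
  ι-+ zero    n = sym (+-identityˡ _)
  ι-+ (suc m) n = trans (+-congˡ (ι-+ m n)) (sym (+-assoc _ _ _))

  ι-* : ∀ m n → ι (m ℕ.* n) ≈ ι m * ι n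
  ι-* zero    n = sym (zeroˡ _)
  ι-* (suc m) n = begin
    ι (n ℕ.+ m ℕ.* n)     ≈⟨ ι-+ n (m ℕ.* n) ⟩
    ι n + ι (m ℕ.* n)     ≈⟨ +-cong (sym (*-identityˡ _)) (ι-* m n) ⟩
    1# * ι n + ι m * ι n  ≈⟨ distribʳ _ _ _ ⟨
    (1# + ι m) * ι n      ∎

  -- The pair `(a , b)` stands for the integer a - b. Unlike elements of `K`, such pairs can be
  -- compared, which the ring solver asks of its coefficients.
  Difference : RawRing 0ℓ 0ℓ
  Difference = record
    { Carrier = ℕ × ℕ
    ; _≈_     = λ { (a , b) (c , d) → a ℕ.+ d ≡ c ℕ.+ b }
    ; _+_     = λ { (a , b) (c , d) → a ℕ.+ c , b ℕ.+ d }
    ; _*_     = λ { (a , b) (c , d) → a ℕ.* c ℕ.+ b ℕ.* d , a ℕ.* d ℕ.+ b ℕ.* c }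
    ; -_      = λ { (a , b) → b , a }
    ; 0#      = 0 , 0
    ; 1#      = 1 , 0
    }
  private module 𝔻 = RawRing Difference

  ⟦_⟧ : ℕ × ℕ → Carrier
  ⟦ a , b ⟧ = ι a - ι b

  +-homo : ∀ x y → ⟦ x 𝔻.+ y ⟧ ≈ ⟦ x ⟧ + ⟦ y ⟧
  +-homo (a , b) (c , d) = begin
    ι (a ℕ.+ c) - ι (b ℕ.+ d)      ≈⟨ +-cong (ι-+ a c) (-‿cong (ι-+ b d)) ⟩
    ι a + ι c - (ι b + ι d)        ≈⟨ +-congˡ (-‿+-comm _ _) ⟨
    ι a + ι c + (- ι b + - ι d)    ≈⟨ interchange _ _ _ _ ⟩
    (ι a - ι b) + (ι c - ι d)      ∎

  -‿homo : ∀ x → ⟦ 𝔻.- x ⟧ ≈ - ⟦ x ⟧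
  -‿homo (a , b) = begin
    ι b - ι a      ≈⟨ +-comm _ _ ⟩
    - ι a + ι b    ≈⟨ +-congˡ (-‿involutive _) ⟨
    - ι a - - ι b  ≈⟨ -‿+-comm _ _ ⟩
    - (ι a - ι b)  ∎

  *-homo : ∀ x y → ⟦ x 𝔻.* y ⟧ ≈ ⟦ x ⟧ * ⟦ y ⟧
  *-homo (a , b) (c , d) = begin
    ⟦ (a ℕ.* c , a ℕ.* d) 𝔻.+ (𝔻.- (b ℕ.* c , b ℕ.* d)) ⟧
      ≈⟨ +-homo (a ℕ.* c , a ℕ.* d) (𝔻.- (b ℕ.* c , b ℕ.* d)) ⟩
    ⟦ a ℕ.* c , a ℕ.* d ⟧ + ⟦ 𝔻.- (b ℕ.* c , b ℕ.* d) ⟧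
      ≈⟨ +-cong (scale a) (trans (-‿homo (b ℕ.* c , b ℕ.* d)) (-‿cong (scale b))) ⟩
    ι a * (ι c - ι d) - ι b * (ι c - ι d)
      ≈⟨ +-congˡ (-‿distribˡ-* _ _) ⟩
    ι a * (ι c - ι d) + - ι b * (ι c - ι d)
      ≈⟨ distribʳ _ _ _ ⟨
    (ι a - ι b) * (ι c - ι d)
      ∎
    where
    scale : ∀ n → ⟦ n ℕ.* c , n ℕ.* d ⟧ ≈ ι n * (ι c - ι d)
    scale n = begin
      ι (n ℕ.* c) - ι (n ℕ.* d)    ≈⟨ +-cong (ι-* n c) (-‿cong (ι-* n d)) ⟩
      ι n * ι c - ι n * ι d        ≈⟨ +-congˡ (-‿distribʳ-* _ _) ⟩
      ι n * ι c + ι n * - ι d      ≈⟨ distribˡ _ _ _ ⟨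
      ι n * (ι c - ι d)            ∎

  0-homo : ⟦ 0 , 0 ⟧ ≈ 0#
  0-homo = -‿inverseʳ 0#

  1-homo : ⟦ 1 , 0 ⟧ ≈ 1#
  1-homo = trans (+-cong (+-identityʳ 1#) -0#≈0#) (+-identityʳ 1#)

  difference-cong : ∀ x y → x 𝔻.≈ y → ⟦ x ⟧ ≈ ⟦ y ⟧
  difference-cong (a , b) (c , d) a+d≡c+b = x-y≈0⇒x≈y _ _ (begin
    ⟦ a , b ⟧ - ⟦ c , d ⟧      ≈⟨ +-congˡ (-‿homo (c , d)) ⟨
    ⟦ a , b ⟧ + ⟦ d , c ⟧      ≈⟨ +-homo (a , b) (d , c) ⟨
    ι (a ℕ.+ d) - ι (b ℕ.+ c)  ≡⟨ ≡.cong₂ (λ m n → ι m - ι n) a+d≡c+b (ℕₚ.+-comm b c) ⟩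
    ι (c ℕ.+ b) - ι (c ℕ.+ b)  ≈⟨ -‿inverseʳ _ ⟩
    0#                         ∎)

  open import Algebra.Solver.Ring.AlmostCommutativeRing

  morphism : Difference -Raw-AlmostCommutative⟶ fromCommutativeRing commutativeRing
  morphism = record
    { ⟦_⟧ = ⟦_⟧ ; +-homo = +-homo ; *-homo = *-homo ; -‿homo = -‿homo ; 0-homo = 0-homo ; 1-homo = 1-homo }

  _coeff≟_ : WeaklyDecidable (Induced-equivalence morphism)
  x@(a , b) coeff≟ y@(c , d) with a ℕ.+ d ℕ.≟ c ℕ.+ b
  ... | yes e = just (difference-cong x y e)
  ... | no _  = nothing

  open import Algebra.Solver.Ring Difference (fromCommutativeRing commutativeRing) morphism _coeff≟_
    using (solve; _:+_; _:*_; _:-_; :-_; _:=_; con) public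

  -- The integer is kept as a witness because the test for zero is carried out on it and not in `K`.
  Integral : Carrier → Set ℓ
  Integral x = Σ (ℕ × ℕ) λ z → x ≈ ⟦ z ⟧

  integral-0 : Integral 0#
  integral-0 = (0 , 0) , sym 0-homo

  integral-1 : Integral 1#
  integral-1 = (1 , 0) , sym 1-homo

  integral-+ : ∀ {x y} → Integral x → Integral y → Integral (x + y)
  integral-+ (z , x≈z) (z′ , y≈z′) = z 𝔻.+ z′ , trans (+-cong x≈z y≈z′) (sym (+-homo z z′))

  integral-* : ∀ {x y} → Integral x → Integral y → Integral (x * y)
  integral-* (z , x≈z) (z′ , y≈z′) = z 𝔻.* z′ , trans (*-cong x≈z y≈z′) (sym (*-homo z z′))

  integral-neg : ∀ {x} → Integral x → Integral (- x)
  integral-neg (z , x≈z) = 𝔻.- z , trans (-‿cong x≈z) (sym (-‿homo z))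

  nonzero-* : ∀ {x y} → ¬ (x ≈ 0#) → ¬ (y ≈ 0#) → ¬ (x * y ≈ 0#)
  nonzero-* {x} {y} x≉0 y≉0 xy≈0 with inverse x x≉0
  ... | x⁻¹ , xx⁻¹≈1 = y≉0 (begin
    y               ≈⟨ *-identityˡ y ⟨
    1# * y          ≈⟨ *-congʳ xx⁻¹≈1 ⟨
    x * x⁻¹ * y     ≈⟨ solve 3 (λ x i y → x :* i :* y := i :* (x :* y)) refl x x⁻¹ y ⟩
    x⁻¹ * (x * y)   ≈⟨ *-congˡ xy≈0 ⟩
    x⁻¹ * 0#        ≈⟨ zeroʳ _ ⟩
    0#              ∎)

  module _ (char0 : CharZero K) where

    ι-injective : ∀ m n → ι m ≈ ι n → m ≡ n
    ι-injective zero    zero    _  = ≡.refl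
    ι-injective zero    (suc n) eq = ⊥-elim (char0 n (sym eq))
    ι-injective (suc m) zero    eq = ⊥-elim (char0 m eq)
    ι-injective (suc m) (suc n) eq = ≡.cong suc (ι-injective m n (+-cancelˡ _ _ _ eq))

    -- In characteristic zero `ι` is injective, so a - b vanishes in `K` exactly when a and b are
    -- the same natural number. This test selects the pivots of the elimination.
    integral≟0 : ∀ {x} → Integral x → Dec (x ≈ 0#)
    integral≟0 ((a , b) , x≈a-b) with a ℕ.≟ b
    ... | yes ≡.refl = yes (trans x≈a-b (-‿inverseʳ _))
    ... | no a≢b     = no λ x≈0 →
      a≢b (ι-injective a b (x-y≈0⇒x≈y _ _ (trans (sym x≈a-b) x≈0)))

    x≈-x⇒x≈0 : ∀ {x} → x ≈ - x → x ≈ 0#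
    x≈-x⇒x≈0 {x} x≈-x with inverse (ι 2) (char0 1)
    ... | ½ , 2½≈1 = begin
      x                 ≈⟨ *-identityˡ x ⟨
      1# * x            ≈⟨ *-congʳ 2½≈1 ⟨
      ι 2 * ½ * x       ≈⟨ *-congʳ (*-congʳ (+-congˡ (+-identityʳ 1#))) ⟩
      (1# + 1#) * ½ * x ≈⟨ solve 3 (λ i h x → (i :+ i) :* h :* x := h :* (i :* x :+ i :* x)) refl 1# ½ x ⟩
      ½ * (1# * x + 1# * x) ≈⟨ *-congˡ (+-cong (*-identityˡ x) (trans (*-identityˡ x) x≈-x)) ⟩
      ½ * (x - x)       ≈⟨ *-congˡ (-‿inverseʳ x) ⟩
      ½ * 0#            ≈⟨ zeroʳ ½ ⟩
      0#                ∎

-- Arithmetic modulo a positive integer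

module Residues (p : ℕ) .{{_ : NonZero p}} where
  open import Data.Nat using (_+_; _*_; _%_; _∸_)
  open ≡ using (refl; sym; trans; cong; cong₂)
  open ≡.≡-Reasoning

  infixl 7 _⊗_
  infixl 6 _⊖_
  _⊗_ = _*F_ p
  _⊖_ = _-F_ p
  ⊝_  = negF p
  𝟎   = 0F p
  𝟏   = 1F p

  mod-cong : ∀ {m n} → m % p ≡ n % p → m mod p ≡ n mod p
  mod-cong eq = toℕ-injective (trans (toℕ-mod _ p) (trans eq (sym (toℕ-mod _ p))))

  toℕ-% : ∀ (a : Zp p) → toℕ a % p ≡ toℕ a
  toℕ-% a = m<n⇒m%n≡m (toℕ<n a)

  mod-+-multiple : ∀ m j → (m + j * p) mod p ≡ m mod p
  mod-+-multiple m j = mod-cong ([m+kn]%n≡m%n m j p)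

  %-*-left : ∀ m n → (m % p * n) % p ≡ (m * n) % p
  %-*-left m n = begin
    (m % p * n) % p              ≡⟨ %-distribˡ-* (m % p) n p ⟩
    (m % p % p * (n % p)) % p    ≡⟨ cong (λ k → (k * (n % p)) % p) (m%n%n≡m%n m p) ⟩
    (m % p * (n % p)) % p        ≡⟨ %-distribˡ-* m n p ⟨
    (m * n) % p                  ∎

  %-*-right : ∀ m n → (m * (n % p)) % p ≡ (m * n) % p
  %-*-right m n = begin
    (m * (n % p)) % p ≡⟨ %-congˡ (ℕₚ.*-comm m _) ⟩
    (n % p * m) % p   ≡⟨ %-*-left n m ⟩
    (n * m) % p       ≡⟨ %-congˡ (ℕₚ.*-comm n m) ⟩
    (m * n) % p       ∎

  %-+-left : ∀ m n → (m % p + n) % p ≡ (m + n) % p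
  %-+-left m n = begin
    (m % p + n) % p              ≡⟨ %-distribˡ-+ (m % p) n p ⟩
    (m % p % p + (n % p)) % p    ≡⟨ cong (λ k → (k + (n % p)) % p) (m%n%n≡m%n m p) ⟩
    (m % p + (n % p)) % p        ≡⟨ %-distribˡ-+ m n p ⟨
    (m + n) % p                  ∎

  %-+-right : ∀ m n → (m + n % p) % p ≡ (m + n) % p
  %-+-right m n = begin
    (m + n % p) % p   ≡⟨ %-congˡ (ℕₚ.+-comm m _) ⟩
    (n % p + m) % p   ≡⟨ %-+-left n m ⟩
    (n + m) % p       ≡⟨ %-congˡ (ℕₚ.+-comm n m) ⟩
    (m + n) % p       ∎

  mod-⊗ : ∀ m n → (m mod p) ⊗ (n mod p) ≡ (m * n) mod p
  mod-⊗ m n = mod-cong (begin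
    (toℕ (m mod p) * toℕ (n mod p)) % p ≡⟨ cong₂ (λ a b → (a * b) % p) (toℕ-mod m p) (toℕ-mod n p) ⟩
    (m % p * (n % p)) % p               ≡⟨ %-distribˡ-* m n p ⟨
    (m * n) % p                         ∎)

  ⊗-comm : ∀ a b → a ⊗ b ≡ b ⊗ a
  ⊗-comm a b = cong (_mod p) (ℕₚ.*-comm (toℕ a) (toℕ b))

  ⊗-assoc : ∀ a b c → (a ⊗ b) ⊗ c ≡ a ⊗ (b ⊗ c)
  ⊗-assoc a b c = mod-cong (begin
    (toℕ (a ⊗ b) * toℕ c) % p              ≡⟨ cong (λ k → (k * toℕ c) % p) (toℕ-mod _ p) ⟩
    ((toℕ a * toℕ b) % p * toℕ c) % p      ≡⟨ %-*-left (toℕ a * toℕ b) (toℕ c) ⟩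
    (toℕ a * toℕ b * toℕ c) % p            ≡⟨ %-congˡ (ℕₚ.*-assoc (toℕ a) (toℕ b) (toℕ c)) ⟩
    (toℕ a * (toℕ b * toℕ c)) % p          ≡⟨ %-*-right (toℕ a) (toℕ b * toℕ c) ⟨
    (toℕ a * ((toℕ b * toℕ c) % p)) % p    ≡⟨ cong (λ k → (toℕ a * k) % p) (toℕ-mod _ p) ⟨
    (toℕ a * toℕ (b ⊗ c)) % p              ∎)

  ⊗-identityˡ : ∀ a → 𝟏 ⊗ a ≡ a
  ⊗-identityˡ a = begin
    𝟏 ⊗ a                 ≡⟨ cong (𝟏 ⊗_) (mod-toℕ a) ⟨
    𝟏 ⊗ (toℕ a mod p)     ≡⟨ mod-⊗ 1 (toℕ a) ⟩
    (1 * toℕ a) mod p     ≡⟨ cong (_mod p) (ℕₚ.*-identityˡ (toℕ a)) ⟩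
    toℕ a mod p           ≡⟨ mod-toℕ a ⟩
    a                     ∎

  ⊗-identityʳ : ∀ a → a ⊗ 𝟏 ≡ a
  ⊗-identityʳ a = trans (⊗-comm a 𝟏) (⊗-identityˡ a)

  toℕ-𝟎 : toℕ 𝟎 ≡ 0
  toℕ-𝟎 = trans (toℕ-mod 0 p) (0%n≡0 p)
    where
    0%n≡0 : ∀ n .{{_ : NonZero n}} → 0 % n ≡ 0
    0%n≡0 (suc n) = refl

  ⊗-zeroˡ : ∀ a → 𝟎 ⊗ a ≡ 𝟎
  ⊗-zeroˡ a = cong (λ k → (k * toℕ a) mod p) toℕ-𝟎

  ⊗-zeroʳ : ∀ a → a ⊗ 𝟎 ≡ 𝟎
  ⊗-zeroʳ a = trans (⊗-comm a 𝟎) (⊗-zeroˡ a)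

  ∸-complement : ∀ (a : Zp p) → toℕ a + (p ∸ toℕ a) ≡ p
  ∸-complement a = ℕₚ.m+[n∸m]≡n (ℕₚ.<⇒≤ (toℕ<n a))

  ⊖-mod : ∀ a b → a ⊖ b ≡ (toℕ a + (p ∸ toℕ b)) mod p
  ⊖-mod a b = mod-cong (trans (cong (λ k → (toℕ a + k) % p) (toℕ-mod _ p)) (%-+-right (toℕ a) (p ∸ toℕ b)))

  𝟎⊖x≡⊝x : ∀ x → 𝟎 ⊖ x ≡ ⊝ x
  𝟎⊖x≡⊝x x = trans (⊖-mod 𝟎 x) (cong (λ k → (k + (p ∸ toℕ x)) mod p) toℕ-𝟎)

  x⊖x≡𝟎 : ∀ x → x ⊖ x ≡ 𝟎
  x⊖x≡𝟎 x = begin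
    x ⊖ x                            ≡⟨ ⊖-mod x x ⟩
    (toℕ x + (p ∸ toℕ x)) mod p      ≡⟨ cong (_mod p) (∸-complement x) ⟩
    p mod p                          ≡⟨ mod-cong ([m+n]%n≡m%n 0 p) ⟩
    𝟎                                ∎

  x⊖y≡𝟎⇒x≡y : ∀ x y → x ⊖ y ≡ 𝟎 → x ≡ y
  x⊖y≡𝟎⇒x≡y x y x⊖y≡𝟎 = toℕ-injective (begin
    toℕ x                                ≡⟨ toℕ-% x ⟨
    toℕ x % p                            ≡⟨ [m+n]%n≡m%n (toℕ x) p ⟨
    (toℕ x + p) % p                      ≡⟨ %-congˡ (cong (toℕ x +_) (trans (ℕₚ.+-comm (p ∸ toℕ y) (toℕ y)) (∸-complement y))) ⟨
    (toℕ x + (p ∸ toℕ y + toℕ y)) % p    ≡⟨ %-congˡ (ℕₚ.+-assoc (toℕ x) (p ∸ toℕ y) (toℕ y)) ⟨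
    (toℕ x + (p ∸ toℕ y) + toℕ y) % p    ≡⟨ %-+-left (toℕ x + (p ∸ toℕ y)) (toℕ y) ⟨
    ((toℕ x + (p ∸ toℕ y)) % p + toℕ y) % p  ≡⟨ cong (λ k → (k + toℕ y) % p) (toℕ-mod _ p) ⟨
    (toℕ ((toℕ x + (p ∸ toℕ y)) mod p) + toℕ y) % p  ≡⟨ cong (λ k → (toℕ k + toℕ y) % p) (trans (sym (⊖-mod x y)) x⊖y≡𝟎) ⟩
    (toℕ 𝟎 + toℕ y) % p                  ≡⟨ cong (λ k → (k + toℕ y) % p) toℕ-𝟎 ⟩
    toℕ y % p                            ≡⟨ toℕ-% y ⟩
    toℕ y                                ∎)

  ⊝𝟎≡𝟎 : ⊝ 𝟎 ≡ 𝟎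
  ⊝𝟎≡𝟎 = trans (sym (𝟎⊖x≡⊝x 𝟎)) (x⊖x≡𝟎 𝟎)

  ⊝x≡𝟎⇒x≡𝟎 : ∀ x → ⊝ x ≡ 𝟎 → x ≡ 𝟎
  ⊝x≡𝟎⇒x≡𝟎 x ⊝x≡𝟎 = sym (x⊖y≡𝟎⇒x≡y 𝟎 x (trans (𝟎⊖x≡⊝x x) ⊝x≡𝟎))

  -- Sums over this monoid are products of residues, which serve the proof of Fermat's theorem.
  ⊗-commutativeMonoid : CommutativeMonoid 0ℓ 0ℓ
  ⊗-commutativeMonoid = record
    { Carrier = Zp p ; _≈_ = _≡_ ; _∙_ = _⊗_ ; ε = 𝟏
    ; isCommutativeMonoid = record
      { isMonoid = record
        { isSemigroup = record
          { isMagma = record { isEquivalence = ≡.isEquivalence ; ∙-cong = cong₂ _⊗_ }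
          ; assoc = ⊗-assoc }
        ; identity = ⊗-identityˡ , ⊗-identityʳ }
      ; comm = ⊗-comm } }

-- Units modulo a prime and Fermat's little theorem

module PrimeResidues (k : ℕ) (pp : Prime (suc (suc k))) where
  p = suc (suc k)
  open Residues p
  open import Data.Nat using (_+_; _*_; _^_)
  open ≡ using (refl; sym; trans; cong; cong₂)
  open ≡.≡-Reasoning

  𝟏≢𝟎 : 𝟏 ≢ 𝟎
  𝟏≢𝟎 ()

  -- Inverses from Bézout's identity have to precede those given by `invF`: showing that `invF`
  -- inverts relies on cancellation of units.
  bezout-inverse : ∀ t → t ≢ 𝟎 → Σ (Zp p) λ s → s ⊗ t ≡ 𝟏
  bezout-inverse fzero t≢𝟎 = ⊥-elim (t≢𝟎 refl)
  bezout-inverse t@(fsuc _) t≢𝟎 with coprime-Bézout (prime⇒coprime pp (toℕ<n t))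
  ... | Bézout.-+ x y eq = y mod p , (begin
    (y mod p) ⊗ t               ≡⟨ cong ((y mod p) ⊗_) (mod-toℕ t) ⟨
    (y mod p) ⊗ (toℕ t mod p)   ≡⟨ mod-⊗ y (toℕ t) ⟩
    (y * toℕ t) mod p           ≡⟨ cong (_mod p) eq ⟨
    (1 + x * p) mod p           ≡⟨ mod-+-multiple 1 x ⟩
    𝟏                           ∎)
  -- Here 1 + y t = x p, so y t ≡ -1 and the inverse is -y. It is written y² t, since (y t)² ≡ 1, to
  -- stay within the natural numbers.
  ... | Bézout.+- x y eq = (y * y * toℕ t) mod p , (begin
    ((y * y * toℕ t) mod p) ⊗ t               ≡⟨ cong (((y * y * toℕ t) mod p) ⊗_) (mod-toℕ t) ⟨
    ((y * y * toℕ t) mod p) ⊗ (toℕ t mod p)   ≡⟨ mod-⊗ (y * y * toℕ t) (toℕ t) ⟩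
    (y * y * toℕ t * toℕ t) mod p             ≡⟨ mod-+-multiple (y * y * toℕ t * toℕ t) x ⟨
    (y * y * toℕ t * toℕ t + x * p) mod p     ≡⟨ cong (λ n → (y * y * toℕ t * toℕ t + n) mod p) eq ⟨
    (y * y * toℕ t * toℕ t + (1 + y * toℕ t)) mod p
      ≡⟨ cong (_mod p) (solve 2 (λ y t → y :* y :* t :* t :+ (con 1 :+ y :* t) :=
                                           con 1 :+ y :* t :* (con 1 :+ y :* t)) refl y (toℕ t)) ⟩
    (1 + y * toℕ t * (1 + y * toℕ t)) mod p   ≡⟨ cong (λ n → (1 + y * toℕ t * n) mod p) eq ⟩
    (1 + y * toℕ t * (x * p)) mod p           ≡⟨ cong (λ n → (1 + n) mod p) (ℕₚ.*-assoc (y * toℕ t) x p) ⟨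
    (1 + y * toℕ t * x * p) mod p             ≡⟨ mod-+-multiple 1 (y * toℕ t * x) ⟩
    𝟏                                         ∎)
    where open +-*-Solver

  ⊗-cancelˡ : ∀ t {a b} → t ≢ 𝟎 → t ⊗ a ≡ t ⊗ b → a ≡ b
  ⊗-cancelˡ t {a} {b} t≢𝟎 eq with bezout-inverse t t≢𝟎
  ... | s , st≡𝟏 = begin
    a             ≡⟨ undo a ⟨
    s ⊗ (t ⊗ a)   ≡⟨ cong (s ⊗_) eq ⟩
    s ⊗ (t ⊗ b)   ≡⟨ undo b ⟩
    b             ∎
    where
    undo : ∀ a → s ⊗ (t ⊗ a) ≡ a
    undo a = trans (sym (⊗-assoc s t a)) (trans (cong (_⊗ a) st≡𝟏) (⊗-identityˡ a))

  ⊗-nonzero : ∀ {t x} → t ≢ 𝟎 → x ≢ 𝟎 → t ⊗ x ≢ 𝟎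
  ⊗-nonzero {t} t≢𝟎 x≢𝟎 tx≡𝟎 = x≢𝟎 (⊗-cancelˡ t t≢𝟎 (trans tx≡𝟎 (sym (⊗-zeroʳ t))))

  scaling : ∀ t → t ≢ 𝟎 → Permutation′ p
  scaling t t≢𝟎 with bezout-inverse t t≢𝟎
  ... | s , st≡𝟏 = permutation (t ⊗_) (s ⊗_)
    (λ a → trans (sym (⊗-assoc t s a)) (trans (cong (_⊗ a) (trans (⊗-comm t s) st≡𝟏)) (⊗-identityˡ a)))
    (λ a → trans (sym (⊗-assoc s t a)) (trans (cong (_⊗ a) st≡𝟏) (⊗-identityˡ a)))

  open import Algebra.Properties.CommutativeMonoid.Sum ⊗-commutativeMonoid
    using () renaming (sum to prod; sum-permute to prod-permute; sum-cong-≗ to prod-cong; ∑-distrib-+ to prod-distrib)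


  -- With 𝟎 sent to the neutral element, the product over all residues, which `scaling` permutes, is
  -- the product of the units.
  unit-part : Zp p → Zp p
  unit-part fzero      = 𝟏
  unit-part x@(fsuc _) = x

  unit-part-nonzero : ∀ {x} → x ≢ 𝟎 → unit-part x ≡ x
  unit-part-nonzero {fzero}  x≢𝟎 = ⊥-elim (x≢𝟎 refl)
  unit-part-nonzero {fsuc _} _   = refl

  prod-nonzero : ∀ {n} (h : Fin n → Zp p) → (∀ i → h i ≢ 𝟎) → prod h ≢ 𝟎
  prod-nonzero {zero}  h h≢𝟎 = 𝟏≢𝟎
  prod-nonzero {suc n} h h≢𝟎 = ⊗-nonzero (h≢𝟎 fzero) (prod-nonzero (λ i → h (fsuc i)) (λ i → h≢𝟎 (fsuc i)))

  prod-constant : ∀ n t → prod {n} (λ _ → t) ≡ (toℕ t ^ n) mod p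
  prod-constant zero    t = refl
  prod-constant (suc n) t = begin
    t ⊗ prod {n} (λ _ → t)                ≡⟨ cong₂ _⊗_ (sym (mod-toℕ t)) (prod-constant n t) ⟩
    (toℕ t mod p) ⊗ ((toℕ t ^ n) mod p)   ≡⟨ mod-⊗ (toℕ t) (toℕ t ^ n) ⟩
    (toℕ t ^ suc n) mod p                 ∎

  -- Fermat's little theorem: multiplication by t permutes the nonzero residues, whose product is a unit.
  ⊗-inverseʳ : ∀ t → t ≢ 𝟎 → t ⊗ invF p t ≡ 𝟏
  ⊗-inverseʳ t t≢𝟎 = begin
    -- As p is `suc (suc k)`, the exponent p - 2 in `invF` is `k`; one more factor gives t to the
    -- power p - 1.
    t ⊗ invF p t                  ≡⟨ cong (t ⊗_) (prod-constant k t) ⟨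
    prod {suc k} (λ _ → t)        ≡⟨ ⊗-identityˡ _ ⟨
    prod factor                   ≡⟨ ⊗-cancelˡ (prod unit-part) (prod-nonzero unit-part unit-part≢𝟎) cancelled ⟩
    𝟏                             ∎
    where
    -- Multiplication by t leaves the 1 that `unit-part` puts at 𝟎 unchanged, so the factor there is
    -- 1. The remaining p - 1 residues each contribute t.
    factor : Zp p → Zp p
    factor fzero    = 𝟏
    factor (fsuc _) = t

    unit-part≢𝟎 : ∀ x → unit-part x ≢ 𝟎
    unit-part≢𝟎 fzero    = 𝟏≢𝟎
    unit-part≢𝟎 (fsuc _) ()

    unit-part-⊗ : ∀ x → unit-part (t ⊗ x) ≡ factor x ⊗ unit-part x
    unit-part-⊗ fzero      = trans (cong unit-part (⊗-zeroʳ t)) (sym (⊗-identityˡ 𝟏))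
    unit-part-⊗ x@(fsuc _) = unit-part-nonzero {t ⊗ x} (⊗-nonzero {t} {x} t≢𝟎 λ ())

    cancelled : prod unit-part ⊗ prod factor ≡ prod unit-part ⊗ 𝟏
    cancelled = begin
      prod unit-part ⊗ prod factor                ≡⟨ ⊗-comm (prod unit-part) (prod factor) ⟩
      prod factor ⊗ prod unit-part                ≡⟨ prod-distrib factor unit-part ⟨
      prod (λ x → factor x ⊗ unit-part x)         ≡⟨ prod-cong unit-part-⊗ ⟨
      prod (λ x → unit-part (t ⊗ x))              ≡⟨ prod-permute unit-part (scaling t t≢𝟎) ⟨
      prod unit-part                              ≡⟨ ⊗-identityʳ _ ⟨
      prod unit-part ⊗ 𝟏                          ∎

  ⊗-/ : ∀ x y → x ≢ 𝟎 → x ⊗ (_/F_ p y x) ≡ y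
  ⊗-/ x y x≢𝟎 = begin
    x ⊗ (y ⊗ invF p x)  ≡⟨ cong (x ⊗_) (⊗-comm y _) ⟩
    x ⊗ (invF p x ⊗ y)  ≡⟨ ⊗-assoc x _ y ⟨
    (x ⊗ invF p x) ⊗ y  ≡⟨ cong (_⊗ y) (⊗-inverseʳ x x≢𝟎) ⟩
    𝟏 ⊗ y               ≡⟨ ⊗-identityˡ y ⟩
    y                   ∎

  ⊗-inverseˡ : ∀ t → t ≢ 𝟎 → invF p t ⊗ t ≡ 𝟏
  ⊗-inverseˡ t t≢𝟎 = trans (⊗-comm (invF p t) t) (⊗-inverseʳ t t≢𝟎)

  invF-nonzero : ∀ t → t ≢ 𝟎 → invF p t ≢ 𝟎
  invF-nonzero t t≢𝟎 eq = 𝟏≢𝟎 (trans (sym (⊗-inverseʳ t t≢𝟎)) (trans (cong (t ⊗_) eq) (⊗-zeroʳ t)))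

  /-nonzero : ∀ {x y} → x ≢ 𝟎 → y ≢ 𝟎 → _/F_ p y x ≢ 𝟎
  /-nonzero {x} x≢𝟎 y≢𝟎 = ⊗-nonzero y≢𝟎 (invF-nonzero x x≢𝟎)

-- Boolean tests on nonzero residues

module ZeroTests (p : ℕ) .{{_ : NonZero p}} where
  nonZero-true : ∀ {x} → x ≢ 0F p → nonZero p x ≡ true
  nonZero-true {x} x≢𝟎 with x ≟ 0F p
  ... | yes x≡𝟎 = ⊥-elim (x≢𝟎 x≡𝟎)
  ... | no _    = ≡.refl

  nonZero³-true : ∀ {x y w} → x ≢ 0F p → y ≢ 0F p → w ≢ 0F p →
                  (nonZero p x ∧ nonZero p y ∧ nonZero p w) ≡ true
  nonZero³-true x≢𝟎 y≢𝟎 w≢𝟎 = ≡.cong₂ _∧_ (nonZero-true x≢𝟎) (≡.cong₂ _∧_ (nonZero-true y≢𝟎) (nonZero-true w≢𝟎))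

-- The common kernel of the R's is Wⁿᶜ

module Noncuspidal {c ℓ} (K : Field c ℓ) (k : ℕ) (pp : Prime (suc (suc k))) where
  open Field K hiding (zero)
  open Integers K
  open Sums K using (sum-zero)
  open PrimeResidues k pp
  open Residues p
  open ZeroTests p
  open import Algebra.Properties.Ring ring using (+-cancelˡ; +-inverseˡ-unique; -0#≈0#)
    renaming (x∙y⁻¹≈ε⇒x≈y to x-y≈0⇒x≈y)
  open import Algebra.Properties.Semiring.Sum semiring
    using (sum; sum-cong-≋; sum-permute; ∑-distrib-+; *-distribʳ-sum)
  open import Relation.Binary.Reasoning.Setoid setoid

  cong₃ : (f : Fn3 K p) → ∀ {x x′ y y′ w w′} → x ≡ x′ → y ≡ y′ → w ≡ w′ → f x y w ≈ f x′ y′ w′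
  cong₃ f ≡.refl ≡.refl ≡.refl = refl

  cong₂ : (f : Fn2 K p) → ∀ {x x′ y y′} → x ≡ x′ → y ≡ y′ → f x y ≈ f x′ y′
  cong₂ f ≡.refl ≡.refl = refl

  β-interior : ∀ f {x y w} → x ≢ 𝟎 → y ≢ 𝟎 → w ≢ 𝟎 → β K p f x y w ≈ 0#
  β-interior f {x} {y} {w} x≢𝟎 y≢𝟎 w≢𝟎 rewrite nonZero³-true {x} {y} {w} x≢𝟎 y≢𝟎 w≢𝟎 = refl

  -- All the points that R reads have nonzero coordinates, so the β part drops out. On α f the terms
  -- f(1:x), f(1:y), f(1:w) telescope, and what is left, f(x:y) + f(y:w) + f(w:x), is the subtracted
  -- term after scaling by x.
  R-vanishes-on-Wnc : ∀ g → InWnc K p g → ∀ {x y w} → x ≢ 𝟎 → y ≢ 𝟎 → w ≢ 𝟎 → R K p x y w g ≈ 0#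
  R-vanishes-on-Wnc g (f , f₂ , ((_ , scale) , _ , anti , _) , _ , g≈) {x} {y} {w} x≢𝟎 y≢𝟎 w≢𝟎 = begin
    g 𝟏 x y + g 𝟏 y w + g 𝟏 w x - g 𝟏 (y ÷ x) (w ÷ x)
      ≈⟨ +-cong (+-cong (+-cong (g-at x≢𝟎 y≢𝟎) (g-at y≢𝟎 w≢𝟎)) (g-at w≢𝟎 x≢𝟎))
                (-‿cong (trans (g-at′ (/-nonzero x≢𝟎 y≢𝟎) (/-nonzero x≢𝟎 w≢𝟎)) (+-cong (+-cong first second) third))) ⟩
    (f 𝟏 x + f x y - f 𝟏 y) + (f 𝟏 y + f y w - f 𝟏 w) + (f 𝟏 w + f w x - f 𝟏 x) - (f x y + f y w + f w x)
      ≈⟨ solve 6 (λ a b c d e f → (a :+ d :- b) :+ (b :+ e :- c) :+ (c :+ f :- a) :- (d :+ e :+ f) := con (0 , 0)) refl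
           (f 𝟏 x) (f 𝟏 y) (f 𝟏 w) (f x y) (f y w) (f w x) ⟩
    ⟦ 0 , 0 ⟧
      ≈⟨ 0-homo ⟩
    0# ∎
    where
    _÷_ = _/F_ p
    g-at′ : ∀ {a b} → a ≢ 𝟎 → b ≢ 𝟎 → g 𝟏 a b ≈ f 𝟏 a + f a b + f b 𝟏
    g-at′ {a} {b} a≢𝟎 b≢𝟎 = trans (g≈ 𝟏 a b)
      (trans (+-congˡ (β-interior f₂ {𝟏} {a} {b} 𝟏≢𝟎 a≢𝟎 b≢𝟎)) (+-identityʳ _))

    g-at : ∀ {a b} → a ≢ 𝟎 → b ≢ 𝟎 → g 𝟏 a b ≈ f 𝟏 a + f a b - f 𝟏 b
    g-at {a} {b} a≢𝟎 b≢𝟎 = trans (g-at′ a≢𝟎 b≢𝟎) (+-congˡ (anti b 𝟏))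

    first : f 𝟏 (y ÷ x) ≈ f x y
    first = trans (sym (scale x 𝟏 (y ÷ x) x≢𝟎)) (cong₂ f (⊗-identityʳ x) (⊗-/ x y x≢𝟎))

    second : f (y ÷ x) (w ÷ x) ≈ f y w
    second = trans (sym (scale x (y ÷ x) (w ÷ x) x≢𝟎)) (cong₂ f (⊗-/ x y x≢𝟎) (⊗-/ x w x≢𝟎))

    third : f (w ÷ x) 𝟏 ≈ f w x
    third = trans (sym (scale x (w ÷ x) 𝟏 x≢𝟎)) (cong₂ f (⊗-/ x w x≢𝟎) (⊗-identityʳ x))

  W0-difference : ∀ {f g} → IsW0 K p f → IsW0 K p g → IsW0 K p (λ x y → f x y - g x y)
  W0-difference {f} {g} ((f00 , fs) , fn , fa , ft , f10) ((g00 , gs) , gn , ga , gt , g10) =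
    (zero-zero f00 g00 , λ t x y t≢𝟎 → minus (fs t x y t≢𝟎) (gs t x y t≢𝟎)) ,
    (λ x y → minus (fn x y) (gn x y)) ,
    (λ x y → trans (minus (fa x y) (ga x y))
      (solve 2 (λ a b → (:- a) :- (:- b) := :- (a :- b)) refl (f y x) (g y x))) ,
    (λ x y → trans
      (solve 6 (λ a b c d e f → (a :- d) :+ (b :- e) :+ (c :- f) := (a :+ b :+ c) :- (d :+ e :+ f)) refl
        (f x y) (f (⊝ y) (x ⊖ y)) (f (y ⊖ x) (⊝ x)) (g x y) (g (⊝ y) (x ⊖ y)) (g (y ⊖ x) (⊝ x)))
      (zero-zero (ft x y) (gt x y))) ,
    zero-zero f10 g10
    where
    minus : ∀ {a b c d} → a ≈ b → c ≈ d → a - c ≈ b - d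
    minus a≈b c≈d = +-cong a≈b (-‿cong c≈d)

    zero-zero : ∀ {a b} → a ≈ 0# → b ≈ 0# → a - b ≈ 0#
    zero-zero a≈0 b≈0 = trans (minus a≈0 b≈0) (-‿inverseʳ 0#)

  module _ (char0 : CharZero K) (f : Fn3 K p) (Wf : IsW K p f) where
    private
      f000  = proj₁ (proj₁ Wf)
      scale = proj₂ (proj₁ Wf)
      cyc   = proj₁ (proj₂ Wf)
      neg   = proj₁ (proj₂ (proj₂ Wf))
      anti  = proj₁ (proj₂ (proj₂ (proj₂ Wf)))
      three = proj₂ (proj₂ (proj₂ (proj₂ Wf)))

    restriction : Fn2 K p
    restriction x y = f x y 𝟎

    restriction-W0 : IsW0 K p restriction
    restriction-W0 =
      (f000 , λ t x y t≢𝟎 → trans (cong₃ f ≡.refl ≡.refl (≡.sym (⊗-zeroʳ t))) (scale t x y 𝟎 t≢𝟎)) ,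
      (λ x y → neg x y 𝟎) ,
      (λ x y → anti x y 𝟎) ,
      (λ x y → three x y 𝟎) ,
      -- Cyclic invariance gives f(1:0:0) = f(0:1:0) and antisymmetry gives the opposite sign.
      x≈-x⇒x≈0 char0 (trans (anti 𝟏 𝟎 𝟎) (-‿cong (sym (cyc 𝟏 𝟎 𝟎))))

    -- `fsuc` enumerates exactly the nonzero residues, of which there are p - 1 = `suc k`.
    fibre : Zp p → Zp p → Fin (suc k) → Carrier
    fibre x y v = f (fsuc v) x y

    fibreSum : Fn2 K p
    fibreSum x y = sum (fibre x y)

    -- Scaling permutes all residues, 𝟎 included. The term at v = 𝟎, itself invariant, is therefore
    -- added to both sides and cancelled.
    fibreSum-scale : ∀ t x y → t ≢ 𝟎 → fibreSum (t ⊗ x) (t ⊗ y) ≈ fibreSum x y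
    fibreSum-scale t x y t≢𝟎 = +-cancelˡ (f 𝟎 x y) _ _ (begin
      f 𝟎 x y + fibreSum (t ⊗ x) (t ⊗ y)
        ≈⟨ +-congʳ (trans (cong₃ f (≡.sym (⊗-zeroʳ t)) ≡.refl ≡.refl) (scale t 𝟎 x y t≢𝟎)) ⟨
      sum (λ v → f v (t ⊗ x) (t ⊗ y))
        ≈⟨ sum-permute (λ v → f v (t ⊗ x) (t ⊗ y)) (scaling t t≢𝟎) ⟩
      sum (λ v → f (t ⊗ v) (t ⊗ x) (t ⊗ y))
        ≈⟨ sum-cong-≋ (λ v → scale t v x y t≢𝟎) ⟩
      f 𝟎 x y + fibreSum x y ∎)

    -- The relations of W act on the first two arguments with the third one fixed, so cyclic
    -- invariance first moves v into third place. The next two relations are inherited in the same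
    -- way.
    fibreSum-neg : ∀ x y → fibreSum x y ≈ fibreSum (⊝ x) y
    fibreSum-neg x y = sum-cong-≋ λ v → begin
      f (fsuc v) x y       ≈⟨ cyc x y (fsuc v) ⟨
      f x y (fsuc v)       ≈⟨ neg x y (fsuc v) ⟩
      f (⊝ x) y (fsuc v)   ≈⟨ cyc (⊝ x) y (fsuc v) ⟩
      f (fsuc v) (⊝ x) y   ∎

    ∑-distrib-+₃ : ∀ {n} (a b c : Fin n → Carrier) →
                   sum (λ i → a i + b i + c i) ≈ sum a + sum b + sum c
    ∑-distrib-+₃ a b c = trans (∑-distrib-+ (λ i → a i + b i) c) (+-congʳ (∑-distrib-+ a b))

    fibreSum-anti : ∀ x y → fibreSum x y ≈ - fibreSum y x
    fibreSum-anti x y = +-inverseˡ-unique _ _ (trans (sym (∑-distrib-+ (fibre x y) (fibre y x))) (sum-zero (λ v → fibre x y v + fibre y x v) λ v → begin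
      f (fsuc v) x y + f (fsuc v) y x    ≈⟨ +-cong (trans (sym (cyc x y (fsuc v))) (anti x y (fsuc v))) (sym (cyc y x (fsuc v))) ⟩
      - f y x (fsuc v) + f y x (fsuc v)  ≈⟨ -‿inverseˡ _ ⟩
      0#                                 ∎))

    fibreSum-three : ∀ x y → fibreSum x y + fibreSum (⊝ y) (x ⊖ y) + fibreSum (y ⊖ x) (⊝ x) ≈ 0#
    fibreSum-three x y = trans (sym (∑-distrib-+₃ (fibre x y) (fibre (⊝ y) (x ⊖ y)) (fibre (y ⊖ x) (⊝ x))))
      (sum-zero (λ v → fibre x y v + fibre (⊝ y) (x ⊖ y) v + fibre (y ⊖ x) (⊝ x) v) λ v → trans
      (sym (+-cong (+-cong (cyc x y (fsuc v)) (cyc (⊝ y) (x ⊖ y) (fsuc v))) (cyc (y ⊖ x) (⊝ x) (fsuc v))))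
      (three x y (fsuc v)))

    ι-sum : ∀ n → ι n ≡ sum {n} (λ _ → 1#)
    ι-sum zero    = ≡.refl
    ι-sum (suc n) = ≡.cong (1# +_) (ι-sum n)

    1/[p-1] : Carrier
    1/[p-1] = proj₁ (inverse (ι (suc k)) (char0 k))

    average-constant : ∀ a → 1/[p-1] * sum {suc k} (λ _ → a) ≈ a
    average-constant a = begin
      1/[p-1] * sum {suc k} (λ _ → a)        ≈⟨ *-congˡ (sum-cong-≋ {suc k} λ _ → *-identityˡ a) ⟨
      1/[p-1] * sum {suc k} (λ _ → 1# * a)   ≈⟨ *-congˡ (*-distribʳ-sum {suc k} a (λ _ → 1#)) ⟨
      1/[p-1] * (sum {suc k} (λ _ → 1#) * a) ≡⟨ ≡.cong (λ n → 1/[p-1] * (n * a)) (ι-sum (suc k)) ⟨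
      1/[p-1] * (ι (suc k) * a)              ≈⟨ *-assoc _ _ _ ⟨
      1/[p-1] * ι (suc k) * a                ≈⟨ *-congʳ (trans (*-comm _ _) (proj₂ (inverse (ι (suc k)) (char0 k)))) ⟩
      1# * a                                 ≈⟨ *-identityˡ a ⟩
      a                                      ∎

    -- The value 0 on the axes is forced: f(1:0) = 0, homogeneity and antisymmetry make every
    -- element of W₀ vanish there.
    average : Fn2 K p
    average x y = if nonZero p x ∧ nonZero p y then 1/[p-1] * fibreSum x y else 0#

    average-interior : ∀ {x y} → x ≢ 𝟎 → y ≢ 𝟎 → average x y ≈ 1/[p-1] * fibreSum x y
    average-interior {x} {y} x≢𝟎 y≢𝟎
      rewrite nonZero-true {x} x≢𝟎 | nonZero-true {y} y≢𝟎 = refl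

    average-𝟎ʳ : ∀ x → average x 𝟎 ≈ 0#
    average-𝟎ʳ fzero = refl
    average-𝟎ʳ (fsuc x) = refl

    average-scale : ∀ t x y → t ≢ 𝟎 → average (t ⊗ x) (t ⊗ y) ≈ average x y
    average-scale t fzero y t≢𝟎 = cong₂ average {y = t ⊗ y} (⊗-zeroʳ t) ≡.refl
    average-scale t x@(fsuc _) fzero t≢𝟎 =
      trans (cong₂ average {x = t ⊗ x} ≡.refl (⊗-zeroʳ t)) (average-𝟎ʳ (t ⊗ x))
    average-scale t x@(fsuc _) y@(fsuc _) t≢𝟎 = begin
      average (t ⊗ x) (t ⊗ y)              ≈⟨ average-interior (⊗-nonzero {t} {x} t≢𝟎 λ ()) (⊗-nonzero {t} {y} t≢𝟎 λ ()) ⟩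
      1/[p-1] * fibreSum (t ⊗ x) (t ⊗ y)   ≈⟨ *-congˡ (fibreSum-scale t x y t≢𝟎) ⟩
      average x y                          ∎

    ⊝-nonzero : ∀ {x} → x ≢ 𝟎 → ⊝ x ≢ 𝟎
    ⊝-nonzero {x} x≢𝟎 ⊝x≡𝟎 = x≢𝟎 (⊝x≡𝟎⇒x≡𝟎 x ⊝x≡𝟎)

    average-neg : ∀ x y → average x y ≈ average (⊝ x) y
    average-neg fzero      y     = cong₂ average {y = y} (≡.sym ⊝𝟎≡𝟎) ≡.refl
    average-neg x@(fsuc _) fzero = sym (average-𝟎ʳ (⊝ x))
    average-neg x@(fsuc _) y@(fsuc _) =
      trans (*-congˡ (fibreSum-neg x y)) (sym (average-interior {⊝ x} {y} (⊝-nonzero {x} λ ()) λ ()))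

    average-anti : ∀ x y → average x y ≈ - average y x
    average-anti fzero      y          = sym (trans (-‿cong (average-𝟎ʳ y)) -0#≈0#)
    average-anti (fsuc _)   fzero      = sym -0#≈0#
    average-anti x@(fsuc _) y@(fsuc _) = trans (*-congˡ (fibreSum-anti x y))
      (solve 2 (λ c s → c :* (:- s) := :- (c :* s)) refl 1/[p-1] (fibreSum y x))

    average-diagonal : ∀ x → average x x ≈ 0#
    average-diagonal x = x≈-x⇒x≈0 char0 (average-anti x x)

    zero₃ : ∀ {a b c} → a ≈ 0# → b ≈ 0# → c ≈ 0# → a + b + c ≈ 0#
    zero₃ a≈0 b≈0 c≈0 = trans (+-cong (trans (+-cong a≈0 b≈0) (+-identityˡ 0#)) c≈0) (+-identityˡ 0#)

    -- If x, y or x - y is zero, each of the three terms lies on an axis or on the diagonal, where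
    -- antisymmetry gives 0. Otherwise all six arguments are nonzero and the relation comes from
    -- `fibreSum`.
    average-three : ∀ x y → average x y + average (⊝ y) (x ⊖ y) + average (y ⊖ x) (⊝ x) ≈ 0#
    average-three fzero y = zero₃ refl
      (trans (cong₂ average {x = ⊝ y} ≡.refl (𝟎⊖x≡⊝x y)) (average-diagonal (⊝ y)))
      (trans (cong₂ average {x = y ⊖ 𝟎} ≡.refl ⊝𝟎≡𝟎) (average-𝟎ʳ (y ⊖ 𝟎)))
    average-three x@(fsuc _) fzero = zero₃ refl
      (cong₂ average {y = x ⊖ 𝟎} ⊝𝟎≡𝟎 ≡.refl)
      (trans (cong₂ average {y = ⊝ x} (𝟎⊖x≡⊝x x) ≡.refl) (average-diagonal (⊝ x)))
    average-three x@(fsuc _) y@(fsuc _) with x ≟ y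
    ... | yes ≡.refl = zero₃ (average-diagonal x)
      (trans (cong₂ average {x = ⊝ x} ≡.refl (x⊖x≡𝟎 x)) (average-𝟎ʳ (⊝ x)))
      (cong₂ average {y = ⊝ x} (x⊖x≡𝟎 x) ≡.refl)
    ... | no x≢y = begin
      average x y + average (⊝ y) (x ⊖ y) + average (y ⊖ x) (⊝ x)
        ≈⟨ +-cong (+-congˡ (average-interior {⊝ y} {x ⊖ y} (⊝-nonzero {y} λ ()) (λ eq → x≢y (x⊖y≡𝟎⇒x≡y x y eq))))
                  (average-interior {y ⊖ x} {⊝ x} (λ eq → x≢y (≡.sym (x⊖y≡𝟎⇒x≡y y x eq))) (⊝-nonzero {x} λ ())) ⟩
      1/[p-1] * fibreSum x y + 1/[p-1] * fibreSum (⊝ y) (x ⊖ y) + 1/[p-1] * fibreSum (y ⊖ x) (⊝ x)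
        ≈⟨ solve 4 (λ c s t u → c :* s :+ c :* t :+ c :* u := c :* (s :+ t :+ u)) refl
             1/[p-1] (fibreSum x y) (fibreSum (⊝ y) (x ⊖ y)) (fibreSum (y ⊖ x) (⊝ x)) ⟩
      1/[p-1] * (fibreSum x y + fibreSum (⊝ y) (x ⊖ y) + fibreSum (y ⊖ x) (⊝ x))
        ≈⟨ *-congˡ (fibreSum-three x y) ⟩
      1/[p-1] * 0#
        ≈⟨ zeroʳ _ ⟩
      0# ∎

    average-W0 : IsW0 K p average
    average-W0 = (refl , average-scale) , average-neg , average-anti , average-three , average-𝟎ʳ 𝟏

    -- This is R = 0 at (x/v, y/v, w/v): homogeneity turns 1 into v in the three added terms, and
    -- clears the quotients in the subtracted one.
    cocycle : (∀ {x y w} → x ≢ 𝟎 → y ≢ 𝟎 → w ≢ 𝟎 → R K p x y w f ≈ 0#) →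
              ∀ v x y w → v ≢ 𝟎 → x ≢ 𝟎 → y ≢ 𝟎 → w ≢ 𝟎 →
              f v x y + f v y w + f v w x ≈ f x y w
    cocycle Rf≈0 v x y w v≢𝟎 x≢𝟎 y≢𝟎 w≢𝟎 = begin
      f v x y + f v y w + f v w x
        ≈⟨ +-cong (+-cong (normalise x y) (normalise y w)) (normalise w x) ⟩
      f 𝟏 (u ⊗ x) (u ⊗ y) + f 𝟏 (u ⊗ y) (u ⊗ w) + f 𝟏 (u ⊗ w) (u ⊗ x)
        ≈⟨ x-y≈0⇒x≈y _ _ (Rf≈0 {u ⊗ x} {u ⊗ y} {u ⊗ w} ux≢𝟎 (⊗-nonzero {u} {y} u≢𝟎 y≢𝟎) (⊗-nonzero {u} {w} u≢𝟎 w≢𝟎)) ⟩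
      f 𝟏 (_/F_ p (u ⊗ y) (u ⊗ x)) (_/F_ p (u ⊗ w) (u ⊗ x))
        ≈⟨ scale (u ⊗ x) 𝟏 _ _ ux≢𝟎 ⟨
      f ((u ⊗ x) ⊗ 𝟏) ((u ⊗ x) ⊗ _/F_ p (u ⊗ y) (u ⊗ x)) ((u ⊗ x) ⊗ _/F_ p (u ⊗ w) (u ⊗ x))
        ≈⟨ cong₃ f (⊗-identityʳ (u ⊗ x)) (⊗-/ (u ⊗ x) (u ⊗ y) ux≢𝟎) (⊗-/ (u ⊗ x) (u ⊗ w) ux≢𝟎) ⟩
      f (u ⊗ x) (u ⊗ y) (u ⊗ w)
        ≈⟨ scale u x y w u≢𝟎 ⟩
      f x y w ∎
      where
      u = invF p v
      u≢𝟎 = invF-nonzero v v≢𝟎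
      ux≢𝟎 = ⊗-nonzero {u} {x} u≢𝟎 x≢𝟎
      normalise : ∀ a b → f v a b ≈ f 𝟏 (u ⊗ a) (u ⊗ b)
      normalise a b = trans (sym (scale u v a b u≢𝟎))
        (cong₃ f {y = u ⊗ a} {w = u ⊗ b} (⊗-inverseˡ v v≢𝟎) ≡.refl ≡.refl)

    -- Averaging over v makes the cocycle (x , y , w) ↦ f x y w on nonzero residues a coboundary.
    α-average-interior : (∀ {x y w} → x ≢ 𝟎 → y ≢ 𝟎 → w ≢ 𝟎 → R K p x y w f ≈ 0#) →
                         ∀ x y w → x ≢ 𝟎 → y ≢ 𝟎 → w ≢ 𝟎 → α K p average x y w ≈ f x y w
    α-average-interior Rf≈0 x y w x≢𝟎 y≢𝟎 w≢𝟎 = begin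
      average x y + average y w + average w x
        ≈⟨ +-cong (+-cong (average-interior x≢𝟎 y≢𝟎) (average-interior y≢𝟎 w≢𝟎)) (average-interior w≢𝟎 x≢𝟎) ⟩
      1/[p-1] * fibreSum x y + 1/[p-1] * fibreSum y w + 1/[p-1] * fibreSum w x
        ≈⟨ solve 4 (λ c s t u → c :* s :+ c :* t :+ c :* u := c :* (s :+ t :+ u)) refl
             1/[p-1] (fibreSum x y) (fibreSum y w) (fibreSum w x) ⟩
      1/[p-1] * (fibreSum x y + fibreSum y w + fibreSum w x)
        ≈⟨ *-congˡ (∑-distrib-+₃ (fibre x y) (fibre y w) (fibre w x)) ⟨
      1/[p-1] * sum (λ v → fibre x y v + fibre y w v + fibre w x v)
        ≈⟨ *-congˡ (sum-cong-≋ λ v → cocycle Rf≈0 (fsuc v) x y w (λ ()) x≢𝟎 y≢𝟎 w≢𝟎) ⟩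
      1/[p-1] * sum {suc k} (λ _ → f x y w)
        ≈⟨ average-constant (f x y w) ⟩
      f x y w ∎

    ∩kerR⊆Wnc : (∀ {x y w} → x ≢ 𝟎 → y ≢ 𝟎 → w ≢ 𝟎 → R K p x y w f ≈ 0#) → InWnc K p f
    ∩kerR⊆Wnc Rf≈0 = average , boundary , average-W0 , W0-difference restriction-W0 average-W0 , decompose
      where
      -- On the plane w = 0 two of the three terms of α `average` lie on axes and vanish, so β has
      -- to supply the restriction minus `average`.
      boundary : Fn2 K p
      boundary x y = f x y 𝟎 - average x y

      absorb : ∀ {a b} → a ≈ 0# + b + 0# + (a - b)
      absorb {a} {b} = sym (begin
        0# + b + 0# + (a - b)  ≈⟨ +-congʳ (trans (+-identityʳ _) (+-identityˡ b)) ⟩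
        b + (a - b)            ≈⟨ solve 2 (λ a b → b :+ (a :- b) := a) refl a b ⟩
        a                      ∎)

      β-plane : ∀ x y → β K p boundary x y 𝟎 ≡ boundary x y
      β-plane fzero    y        = ≡.refl
      β-plane (fsuc _) fzero    = ≡.refl
      β-plane (fsuc _) (fsuc _) = ≡.refl

      decompose : ∀ x y w → f x y w ≈ α K p average x y w + β K p boundary x y w
      decompose x@(fsuc _) y@(fsuc _) w@(fsuc _) = sym (trans (+-identityʳ _)
        (α-average-interior Rf≈0 x y w (λ ()) (λ ()) (λ ())))
      -- The cases follow the tests in `β`, which look at w before x: a point with several zero
      -- coordinates is treated under w = 0 if possible, else under x = 0.
      decompose fzero y w@(fsuc _) = begin
        f 𝟎 y w                                                          ≈⟨ cyc y w 𝟎 ⟨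
        f y w 𝟎                                                          ≈⟨ absorb ⟩
        0# + average y w + 0# + boundary y w                             ≈⟨ +-congʳ (+-congˡ (average-𝟎ʳ w)) ⟨
        α K p average 𝟎 y w + boundary y w                               ∎
      decompose x@(fsuc _) fzero w@(fsuc _) = begin
        f x 𝟎 w                                                          ≈⟨ cyc x 𝟎 w ⟩
        f w x 𝟎                                                          ≈⟨ absorb ⟩
        0# + average w x + 0# + boundary w x                             ≈⟨ +-congʳ (trans (+-identityʳ _) (+-congʳ (sym (+-identityˡ 0#)))) ⟩
        α K p average x 𝟎 w + boundary w x                               ∎
      decompose x y fzero = begin
        f x y 𝟎                                                          ≈⟨ absorb ⟩
        0# + average x y + 0# + boundary x y                             ≈⟨ +-congʳ (+-cong (trans (+-comm _ _) (+-congˡ (sym (average-𝟎ʳ y)))) refl) ⟩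
        α K p average x y 𝟎 + boundary x y                               ≈⟨ +-congˡ (reflexive (β-plane x y)) ⟨
        α K p average x y 𝟎 + β K p boundary x y 𝟎                       ∎

-- Linear forms on the space of all functions of triples

module Forms {c ℓ} (K : Field c ℓ) (p : ℕ) .{{_ : NonZero p}} where
  open Field K hiding (zero)
  open Integers K
  open Sums K using (sum-zero)
  open import Algebra.Properties.Ring ring using (-‿distribʳ-*; -‿distribˡ-*; -‿+-comm)
    renaming (x∙y⁻¹≈ε⇒x≈y to x-y≈0⇒x≈y)
  open import Algebra.Properties.CommutativeSemigroup +-commutativeSemigroup using (interchange)
  open import Algebra.Properties.CommutativeSemigroup *-commutativeSemigroup using (x∙yz≈y∙xz)
  open import Algebra.Properties.Semiring.Sum semiring
    using (sum; sum-cong-≋; ∑-distrib-+; *-distribˡ-sum)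
  open import Relation.Binary.Reasoning.Setoid setoid

  V : Set c
  V = Fn3 K p

  infix 4 _≋_
  _≋_ : V → V → Set ℓ
  f ≋ g = ∀ x y w → f x y w ≈ g x y w

  infixl 6 _+v_
  infixr 7 _·v_
  _+v_ : V → V → V
  _+v_ = _+₃_ K p

  _·v_ : Carrier → V → V
  _·v_ = _·₃_ K p

  -- Unlike a `Functional`, a form takes no proof of membership in W, so it can be composed with
  -- arbitrary operators and evaluated on the standard basis.
  record Form : Set (c ⊔ ℓ) where
    field
      fn    : V → Carrier
      cong  : ∀ {f g} → f ≋ g → fn f ≈ fn g
      add   : ∀ f g → fn (f +v g) ≈ fn f + fn g
      scale : ∀ a f → fn (a ·v f) ≈ a * fn f

    fn-zero : ∀ {f} → (∀ x y w → f x y w ≈ 0#) → fn f ≈ 0#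
    fn-zero {f} f≈0 = begin
      fn f          ≈⟨ cong (λ x y w → trans (f≈0 x y w) (sym (zeroˡ _))) ⟩
      fn (0# ·v f)  ≈⟨ scale 0# f ⟩
      0# * fn f     ≈⟨ zeroˡ _ ⟩
      0#            ∎

    fn-sum : ∀ {n} (g : Fin n → V) → fn (λ x y w → sum (λ i → g i x y w)) ≈ sum (λ i → fn (g i))
    fn-sum {zero}  g = fn-zero (λ _ _ _ → refl)
    fn-sum {suc n} g = trans (add (g fzero) _) (+-congˡ (fn-sum (λ i → g (fsuc i))))
  open Form public

  coordinate : Zp p → Zp p → Zp p → Form
  coordinate x y w = record
    { fn = λ f → f x y w ; cong = λ f≋g → f≋g x y w ; add = λ _ _ → refl ; scale = λ _ _ → refl }

  infixl 6 _⊞_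
  infixr 7 _⊡_
  _⊞_ : Form → Form → Form
  l ⊞ m = record
    { fn    = λ f → fn l f + fn m f
    ; cong  = λ f≋g → +-cong (cong l f≋g) (cong m f≋g)
    ; add   = λ f g → trans (+-cong (add l f g) (add m f g)) (interchange _ _ _ _)
    ; scale = λ a f → trans (+-cong (scale l a f) (scale m a f)) (sym (distribˡ _ _ _))
    }

  _⊡_ : Carrier → Form → Form
  b ⊡ l = record
    { fn    = λ f → b * fn l f
    ; cong  = λ f≋g → *-congˡ (cong l f≋g)
    ; add   = λ f g → trans (*-congˡ (add l f g)) (distribˡ _ _ _)
    ; scale = λ a f → trans (*-congˡ (scale l a f)) (x∙yz≈y∙xz b a (fn l f))
    }

  -- An endomorphism of `V` given by its rows, whose linearity is then that of the rows.
  Operator : Set (c ⊔ ℓ)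
  Operator = Zp p → Zp p → Zp p → Form

  apply : Operator → V → V
  apply P f x y w = fn (P x y w) f

  infixr 8 _⊙_
  _⊙_ : Form → Operator → Form
  l ⊙ P = record
    { fn    = λ f → fn l (apply P f)
    ; cong  = λ f≋g → cong l (λ x y w → cong (P x y w) f≋g)
    ; add   = λ f g → trans (cong l (λ x y w → add (P x y w) f g)) (add l _ _)
    ; scale = λ a f → trans (cong l (λ x y w → scale (P x y w) a f)) (scale l a _)
    }

  indicator : ∀ {n} → Fin n → Fin n → Carrier
  indicator fzero    fzero    = 1#
  indicator fzero    (fsuc _) = 0#
  indicator (fsuc _) fzero    = 0#
  indicator (fsuc i) (fsuc j) = indicator i j

  indicator-sym : ∀ {n} (i j : Fin n) → indicator i j ≡ indicator j i
  indicator-sym fzero    fzero    = ≡.refl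
  indicator-sym fzero    (fsuc _) = ≡.refl
  indicator-sym (fsuc _) fzero    = ≡.refl
  indicator-sym (fsuc i) (fsuc j) = indicator-sym i j

  integral-indicator : ∀ {n} (i j : Fin n) → Integral (indicator i j)
  integral-indicator fzero    fzero    = integral-1
  integral-indicator fzero    (fsuc _) = integral-0
  integral-indicator (fsuc _) fzero    = integral-0
  integral-indicator (fsuc i) (fsuc j) = integral-indicator i j

  sum-indicator : ∀ {n} (i : Fin n) (g : Fin n → Carrier) → sum (λ j → indicator i j * g j) ≈ g i
  sum-indicator {suc n} fzero g = trans
    (+-cong (*-identityˡ _) (sum-zero {n} _ λ j → zeroˡ (g (fsuc j)))) (+-identityʳ _)
  sum-indicator {suc n} (fsuc i) g = trans
    (+-cong (zeroˡ _) (sum-indicator i (λ j → g (fsuc j)))) (+-identityˡ _)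

  sum³ : V → Carrier
  sum³ f = sum λ x → sum λ y → sum λ w → f x y w

  sum³-cong : ∀ {f g} → f ≋ g → sum³ f ≈ sum³ g
  sum³-cong f≋g = sum-cong-≋ λ x → sum-cong-≋ λ y → sum-cong-≋ λ w → f≋g x y w

  sum³-+ : ∀ f g → sum³ (f +v g) ≈ sum³ f + sum³ g
  sum³-+ f g = trans
    (sum-cong-≋ λ x → trans
      (sum-cong-≋ λ y → ∑-distrib-+ (f x y) (g x y))
      (∑-distrib-+ (λ y → sum (f x y)) (λ y → sum (g x y))))
    (∑-distrib-+ (λ x → sum λ y → sum (f x y)) (λ x → sum λ y → sum (g x y)))

  sum³-· : ∀ a f → sum³ (a ·v f) ≈ a * sum³ f
  sum³-· a f = sym (trans (*-distribˡ-sum a (λ x → sum λ y → sum (f x y)))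
    (sum-cong-≋ λ x → trans (*-distribˡ-sum a (λ y → sum (f x y)))
      (sum-cong-≋ λ y → *-distribˡ-sum a (f x y))))

  δ : Zp p → Zp p → Zp p → V
  δ a b d x y w = indicator a x * (indicator b y * indicator d w)

  integral-δ : ∀ a b d x y w → Integral (δ a b d x y w)
  integral-δ a b d x y w =
    integral-* (integral-indicator a x) (integral-* (integral-indicator b y) (integral-indicator d w))

  sum³-δ : ∀ a b d (g : V) → sum³ (λ x y w → δ a b d x y w * g x y w) ≈ g a b d
  sum³-δ a b d g = begin
    sum³ (λ x y w → δ a b d x y w * g x y w)
      ≈⟨ sum³-cong (λ x y w → solve 4 (λ i j k g → i :* (j :* k) :* g := k :* (i :* (j :* g))) refl
           (indicator a x) (indicator b y) (indicator d w) (g x y w)) ⟩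
    sum³ (λ x y w → indicator d w * (indicator a x * (indicator b y * g x y w)))
      ≈⟨ (sum-cong-≋ λ x → sum-cong-≋ λ y → sum-indicator d (λ w → indicator a x * (indicator b y * g x y w))) ⟩
    sum (λ x → sum (λ y → indicator a x * (indicator b y * g x y d)))
      ≈⟨ (sum-cong-≋ λ x → sum-cong-≋ λ y → x∙yz≈y∙xz (indicator a x) (indicator b y) (g x y d)) ⟩
    sum (λ x → sum (λ y → indicator b y * (indicator a x * g x y d)))
      ≈⟨ (sum-cong-≋ λ x → sum-indicator b (λ y → indicator a x * g x y d)) ⟩
    sum (λ x → indicator a x * g x b d)
      ≈⟨ sum-indicator a (λ x → g x b d) ⟩
    g a b d ∎

  δ-sym : ∀ a b d x y w → δ a b d x y w ≡ δ x y w a b d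
  δ-sym a b d x y w = ≡.cong₂ _*_ (indicator-sym a x) (≡.cong₂ _*_ (indicator-sym b y) (indicator-sym d w))

  form-expansion : ∀ l f → fn l f ≈ sum³ (λ a b d → f a b d * fn l (δ a b d))
  form-expansion l f = begin
    fn l f
      ≈⟨ cong l (λ x y w → trans (sym (sum³-δ x y w f)) (sum³-cong λ a b d →
           trans (*-congʳ (reflexive (δ-sym x y w a b d))) (*-comm _ _))) ⟩
    fn l (λ x y w → sum³ (λ a b d → f a b d * δ a b d x y w))
      ≈⟨ fn-sum l (λ a x y w → sum λ b → sum λ d → f a b d * δ a b d x y w) ⟩
    sum (λ a → fn l (λ x y w → sum λ b → sum λ d → f a b d * δ a b d x y w))
      ≈⟨ (sum-cong-≋ λ a → trans
           (fn-sum l (λ b x y w → sum λ d → f a b d * δ a b d x y w))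
           (sum-cong-≋ λ b → trans
             (fn-sum l (λ d x y w → f a b d * δ a b d x y w))
             (sum-cong-≋ λ d → scale l (f a b d) (δ a b d)))) ⟩
    sum³ (λ a b d → f a b d * fn l (δ a b d)) ∎

  form-vanishes : ∀ l → (∀ x y w → fn l (δ x y w) ≈ 0#) → ∀ f → fn l f ≈ 0#
  form-vanishes l lδ≈0 f = trans (form-expansion l f)
    (sum-zero _ λ x → sum-zero _ λ y → sum-zero _ λ w →
      trans (*-congˡ (lδ≈0 x y w)) (zeroʳ (f x y w)))

  -- Syntax for forms with integer coefficients. The equations of W and the R's all have this shape,
  -- and induction on it shows that they take integral functions to integers.
  data Expr : Set where
    at  : Zp p → Zp p → Zp p → Expr
    𝕠   : Expr
    _⊕_ : Expr → Expr → Expr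
    ⊖_  : Expr → Expr

  infixl 6 _⊕_
  infix  8 ⊖_

  eval : Expr → V → Carrier
  eval (at x y w) f = f x y w
  eval 𝕠          f = 0#
  eval (l ⊕ m)    f = eval l f + eval m f
  eval (⊖ l)      f = - eval l f

  ⟪_⟫ : Expr → Form
  ⟪ l ⟫ = record { fn = eval l ; cong = eval-cong l ; add = eval-add l ; scale = eval-scale l }
    where
    eval-cong : ∀ l {f g} → f ≋ g → eval l f ≈ eval l g
    eval-cong (at x y w) f≋g = f≋g x y w
    eval-cong 𝕠          f≋g = refl
    eval-cong (l ⊕ m)    f≋g = +-cong (eval-cong l f≋g) (eval-cong m f≋g)
    eval-cong (⊖ l)      f≋g = -‿cong (eval-cong l f≋g)

    eval-add : ∀ l f g → eval l (f +v g) ≈ eval l f + eval l g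
    eval-add (at x y w) f g = refl
    eval-add 𝕠          f g = sym (+-identityˡ 0#)
    eval-add (l ⊕ m)    f g = trans (+-cong (eval-add l f g) (eval-add m f g)) (interchange _ _ _ _)
    eval-add (⊖ l)      f g = trans (-‿cong (eval-add l f g)) (sym (-‿+-comm _ _))

    eval-scale : ∀ l a f → eval l (a ·v f) ≈ a * eval l f
    eval-scale (at x y w) a f = refl
    eval-scale 𝕠          a f = sym (zeroʳ a)
    eval-scale (l ⊕ m)    a f = trans (+-cong (eval-scale l a f) (eval-scale m a f)) (sym (distribˡ _ _ _))
    eval-scale (⊖ l)      a f = trans (-‿cong (eval-scale l a f)) (-‿distribʳ-* _ _)

  PreservesIntegrality : Form → Set (c ⊔ ℓ)
  PreservesIntegrality l = ∀ f → (∀ x y w → Integral (f x y w)) → Integral (fn l f)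

  integral-eval : ∀ l → PreservesIntegrality ⟪ l ⟫
  integral-eval (at x y w) f int = int x y w
  integral-eval 𝕠          f int = integral-0
  integral-eval (l ⊕ m)    f int = integral-+ (integral-eval l f int) (integral-eval m f int)
  integral-eval (⊖ l)      f int = integral-neg (integral-eval l f int)

  -- Elimination modulo a subspace of forms

  -- An arbitrary predicate, so that one elimination serves two purposes: for forms vanishing on W,
  -- and for forms that agree on W with a combination of the R's.
  record Subspace v : Set (c ⊔ ℓ ⊔ Level.suc v) where
    field
      member : Form → Set v
      zero-member : member ⟪ 𝕠 ⟫
      resp-≈ : ∀ {l m} → (∀ f → fn l f ≈ fn m f) → member l → member m
      ⊞-closed : ∀ {l m} → member l → member m → member (l ⊞ m)
      ⊡-closed : ∀ a {l} → member l → member (a ⊡ l)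

  -- Fraction-free Gaussian elimination.  Equality in K is undecidable, but the equations have
  -- integer coefficients, so a pivot can be found among integers.
  module Elimination (char0 : CharZero K) {v} (𝒱 : Subspace v) where
    open Subspace 𝒱

    -- P acts as multiplication by factor on the vectors annihilated by 𝒱.
    record Projection (T : V → Set ℓ) : Set (c ⊔ ℓ ⊔ v) where
      field
        P            : Operator
        factor       : Carrier
        factor≉0     : ¬ (factor ≈ 0#)
        P-integral   : ∀ x y w → PreservesIntegrality (P x y w)
        P-into       : ∀ f → T (apply P f)
        P-residue    : ∀ Ψ → member (Ψ ⊙ P ⊞ (- factor) ⊡ Ψ)
    open Projection

    -- Quantifying over every projection obtained so far lets conditions be added one after another,
    -- so a system of equations is treated along its logical connectives.
    Reducible : (V → Set ℓ) → Set (c ⊔ Level.suc ℓ ⊔ v)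
    Reducible S = ∀ T → Projection T → Projection (λ f → T f × S f)

    weaken : ∀ {T T′} → (∀ f → T f → T′ f) → Projection T → Projection T′
    weaken T⊆T′ π = record
      { P = P π ; factor = factor π ; factor≉0 = factor≉0 π
      ; P-integral = P-integral π ; P-into = λ f → T⊆T′ _ (P-into π f) ; P-residue = P-residue π }

    -- With b = l(P e) ≠ 0, put Q f = b f - l(P f) e. Then l(P(Q f)) = b l(P f) - l(P f) b = 0, and
    -- since P is applied after Q, the image of the new operator still satisfies `T`. No division
    -- occurs.
    pivot : ∀ l → member ⟪ l ⟫ → ∀ {T} (π : Projection T) e → (∀ x y w → Integral (e x y w)) →
            ¬ (eval l (apply (P π) e) ≈ 0#) → Projection (λ f → T f × eval l f ≈ 0#)
    pivot l l∈𝒱 π e e-int lPe≉0 = record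
      { P          = λ x y w → P π x y w ⊙ Q
      ; factor     = b * factor π
      ; factor≉0   = nonzero-* lPe≉0 (factor≉0 π)
      ; P-integral = λ x y w f int → P-integral π x y w _ λ x y w →
          integral-+ (integral-* b-int (int x y w)) (integral-* (integral-neg (e-int x y w)) (lP-integral f int))
      ; P-into     = λ f → P-into π (apply Q f) , trans (after-Q lP f)
          (trans (solve 2 (λ b m → b :* m :+ (:- m) :* b := con (0 , 0)) refl b (fn lP f)) 0-homo)
      ; P-residue  = residue
      }
      where
      lP = ⟪ l ⟫ ⊙ P π
      b  = fn lP e

      lP-integral : PreservesIntegrality lP
      lP-integral f int = integral-eval l (apply (P π) f) (λ x y w → P-integral π x y w f int)

      b-int : Integral b
      b-int = lP-integral e e-int

      Q : Operator
      Q x y w = (b ⊡ coordinate x y w) ⊞ ((- e x y w) ⊡ lP)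

      after-Q : ∀ m f → fn m (apply Q f) ≈ b * fn m f + (- fn lP f) * fn m e
      after-Q m f = begin
        fn m (apply Q f)
          ≈⟨ cong m (λ x y w → +-congˡ (solve 2 (λ e a → (:- e) :* a := (:- a) :* e) refl (e x y w) (fn lP f))) ⟩
        fn m (b ·v f +v (- fn lP f) ·v e)
          ≈⟨ trans (add m _ _) (+-cong (scale m _ _) (scale m _ _)) ⟩
        b * fn m f + (- fn lP f) * fn m e ∎

      residue : ∀ Ψ → member (Ψ ⊙ (λ x y w → P π x y w ⊙ Q) ⊞ (- (b * factor π)) ⊡ Ψ)
      -- With φ the old factor, ΨPQ - bφΨ = b (ΨP - φΨ) - Ψ(Pe) (lP - φl) - Ψ(Pe) φ l. The two
      -- differences are old residues and l is a member by hypothesis.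
      residue Ψ = resp-≈
        (λ f → sym (trans (+-congʳ (after-Q (Ψ ⊙ P π) f))
          (solve 7 (λ b ψPf lPf ψPe φ ψf lf →
             (b :* ψPf :+ (:- lPf) :* ψPe) :+ (:- (b :* φ)) :* ψf :=
             b :* (ψPf :+ (:- φ) :* ψf) :+ ((:- ψPe) :* (lPf :+ (:- φ) :* lf) :+ (:- (ψPe :* φ)) :* lf)) refl
             b (fn (Ψ ⊙ P π) f) (fn lP f) (fn (Ψ ⊙ P π) e) (factor π) (fn Ψ f) (eval l f))))
        (⊞-closed (⊡-closed b (P-residue π Ψ))
             (⊞-closed (⊡-closed (- fn (Ψ ⊙ P π) e) (P-residue π ⟪ l ⟫))
                  (⊡-closed (- (fn (Ψ ⊙ P π) e * factor π)) l∈𝒱)))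

    -- The values of l ∘ P on the basis functions are integers, so a nonzero one can be searched
    -- for. If there is one, it is a pivot; if not, l ∘ P vanishes on a basis, hence everywhere, and
    -- P already satisfies the equation.
    reducible-zero : ∀ l → member ⟪ l ⟫ → Reducible (λ f → eval l f ≈ 0#)
    reducible-zero l l∈𝒱 T π
      with any? (λ x → any? λ y → any? λ w → ¬? (integral≟0 char0 (lPδ-integral x y w)))
      where
      lPδ-integral : ∀ x y w → Integral (fn (⟪ l ⟫ ⊙ P π) (δ x y w))
      lPδ-integral x y w = integral-eval l (apply (P π) (δ x y w))
        (λ x′ y′ w′ → P-integral π x′ y′ w′ (δ x y w) (integral-δ x y w))
    ... | yes (x , y , w , lPδ≉0) = pivot l l∈𝒱 π (δ x y w) (integral-δ x y w) lPδ≉0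
    ... | no ¬∃ = record
      { P = P π ; factor = factor π ; factor≉0 = factor≉0 π ; P-integral = P-integral π ; P-residue = P-residue π
      ; P-into = λ f → P-into π f , form-vanishes (⟪ l ⟫ ⊙ P π) lPδ≈0 f }
      where
      lPδ≈0 : ∀ x y w → fn (⟪ l ⟫ ⊙ P π) (δ x y w) ≈ 0#
      lPδ≈0 x y w = decidable-stable (integral≟0 char0 (integral-eval l (apply (P π) (δ x y w))
        (λ x′ y′ w′ → P-integral π x′ y′ w′ (δ x y w) (integral-δ x y w)))) (λ lPδ≉0 → ¬∃ (x , y , w , lPδ≉0))

    reducible-⇔ : ∀ {S S′} → (∀ f → S f → S′ f) → Reducible S → Reducible S′
    reducible-⇔ S⇒S′ red T π = weaken (λ f (t , s) → t , S⇒S′ f s) (red T π)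

    reducible-≈ : ∀ l m → member ⟪ l ⊕ ⊖ m ⟫ → Reducible (λ f → eval l f ≈ eval m f)
    reducible-≈ l m ∈𝒱 = reducible-⇔ (λ f → x-y≈0⇒x≈y _ _) (reducible-zero (l ⊕ ⊖ m) ∈𝒱)

    reducible-× : ∀ {S S′} → Reducible S → Reducible S′ → Reducible (λ f → S f × S′ f)
    reducible-× red red′ T π = weaken (λ f ((t , s) , s′) → t , s , s′) (red′ _ (red T π))

    reducible-∀ : ∀ {n} {S : Fin n → V → Set ℓ} → (∀ i → Reducible (S i)) → Reducible (λ f → ∀ i → S i f)
    reducible-∀ {zero}      red T π = weaken (λ f t → t , λ ()) π
    reducible-∀ {suc n} {S} red T π =
      weaken (λ f ((t , s₀) , s) → t , λ { fzero → s₀ ; (fsuc i) → s i })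
        (reducible-∀ (λ i → red (fsuc i)) _ (red fzero T π))

    reducible-→ : ∀ {A : Set} {S} → Dec A → (A → Reducible S) → Reducible (λ f → A → S f)
    reducible-→ (yes a) red T π = weaken (λ f (t , s) → t , λ _ → s) (red a T π)
    reducible-→ (no ¬a) red T π = weaken (λ f t → t , λ a → ⊥-elim (¬a a)) π

    identity-projection : Projection (λ _ → ⊤)
    identity-projection = record
      { P = coordinate ; factor = 1# ; factor≉0 = λ 1≈0 → 0≉1 (sym 1≈0)
      ; P-integral = λ x y w f int → int x y w
      ; P-into = λ _ → tt
      ; P-residue = λ Ψ → resp-≈ (λ f → sym (trans (+-congˡ (trans (sym (-‿distribˡ-* 1# (fn Ψ f)))
          (-‿cong (*-identityˡ _)))) (-‿inverseʳ (fn Ψ f)))) zero-member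
      }

    module _ (member-vanishing : ∀ l → (∀ f → IsW K p f → fn l f ≈ 0#) → member l) where
      private
        z = 0F p

        equation : ∀ l m → (∀ f → IsW K p f → eval l f ≈ eval m f) → Reducible (λ f → eval l f ≈ eval m f)
        equation l m l≈m = reducible-≈ l m (member-vanishing ⟪ l ⊕ ⊖ m ⟫ λ f Wf →
          trans (+-congʳ (l≈m f Wf)) (-‿inverseʳ _))

      -- Membership in W is a finite conjunction of linear equations, one family of them guarded by
      -- the decidable condition t ≠ 0. By `member-vanishing` the difference of the two sides of
      -- each lies in 𝒱.
      W-reducible : Reducible (IsW K p)
      W-reducible =
        reducible-×
          (reducible-× (equation (at z z z) 𝕠 λ f Wf → proj₁ (proj₁ Wf))
            (reducible-∀ λ t → reducible-∀ λ x → reducible-∀ λ y → reducible-∀ λ w →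
              reducible-→ (¬? (t ≟ z)) λ t≢z →
                equation (at (_*F_ p t x) (_*F_ p t y) (_*F_ p t w)) (at x y w) λ f Wf → proj₂ (proj₁ Wf) t x y w t≢z))
        (reducible-×
          (reducible-∀ λ x → reducible-∀ λ y → reducible-∀ λ w →
            equation (at x y w) (at w x y) λ f Wf → proj₁ (proj₂ Wf) x y w)
        (reducible-×
          (reducible-∀ λ x → reducible-∀ λ y → reducible-∀ λ w →
            equation (at x y w) (at (negF p x) y w) λ f Wf → proj₁ (proj₂ (proj₂ Wf)) x y w)
        (reducible-×
          (reducible-∀ λ x → reducible-∀ λ y → reducible-∀ λ w →
            equation (at x y w) (⊖ at y x w) λ f Wf → proj₁ (proj₂ (proj₂ (proj₂ Wf))) x y w)
          (reducible-∀ λ x → reducible-∀ λ y → reducible-∀ λ w →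
            equation (at x y w ⊕ at (negF p y) (_-F_ p x y) w ⊕ at (_-F_ p y x) (negF p x) w) 𝕠
              λ f Wf → proj₂ (proj₂ (proj₂ (proj₂ Wf))) x y w))))

      W-projection : Projection (IsW K p)
      W-projection = weaken (λ f → proj₂) (W-reducible _ identity-projection)

-- The span of the R's and the annihilator of Wⁿᶜ

module Duality {c ℓ} (K : Field c ℓ) (char0 : CharZero K) (k : ℕ) (pp : Prime (suc (suc k))) where
  p : ℕ
  p = suc (suc k)

  open Field K hiding (zero)
  open Integers K
  open Forms K p
  open Noncuspidal K k pp using (R-vanishes-on-Wnc; ∩kerR⊆Wnc)
  open Sums K using (sum-zero; sumZp≈sum)
  open Residues p using (𝟎; 𝟏)
  open ZeroTests p
  open import Algebra.Properties.Ring ring using (-‿distribˡ-*)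
    renaming (x∙y⁻¹≈ε⇒x≈y to x-y≈0⇒x≈y)
  open import Algebra.Properties.Semiring.Sum semiring using (sum; sum-cong-≋)
  open import Relation.Binary.Reasoning.Setoid setoid

  -- `φ` takes a membership proof, which has to be carried along whenever its argument is rewritten.
  W-resp-≋ : ∀ {f g} → f ≋ g → IsW K p f → IsW K p g
  W-resp-≋ f≋g ((f000 , scl) , cyc , neg , anti , three) =
    (trans (sym (f≋g _ _ _)) f000 , λ t x y w t≢𝟎 → both (f≋g _ _ _) (f≋g _ _ _) (scl t x y w t≢𝟎)) ,
    (λ x y w → both (f≋g _ _ _) (f≋g _ _ _) (cyc x y w)) ,
    (λ x y w → both (f≋g _ _ _) (f≋g _ _ _) (neg x y w)) ,
    (λ x y w → both (f≋g _ _ _) (-‿cong (f≋g _ _ _)) (anti x y w)) ,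
    (λ x y w → both (+-cong (+-cong (f≋g _ _ _) (f≋g _ _ _)) (f≋g _ _ _)) refl (three x y w))
    where
    both : ∀ {a b a′ b′} → a ≈ a′ → b ≈ b′ → a ≈ b → a′ ≈ b′
    both a≈a′ b≈b′ a≈b = trans (sym a≈a′) (trans a≈b b≈b′)

  -- The mask is put on R alone and not on the product as in `InV`, which makes `combination`
  -- visibly linear in the coefficients.
  maskedR : V → V
  maskedR f x y w = if nonZero p x ∧ nonZero p y ∧ nonZero p w then R K p x y w f else 0#

  maskedR-interior : ∀ f {x y w} → x ≢ 𝟎 → y ≢ 𝟎 → w ≢ 𝟎 → maskedR f x y w ≈ R K p x y w f
  maskedR-interior f {x} {y} {w} x≢𝟎 y≢𝟎 w≢𝟎 rewrite nonZero³-true {x} {y} {w} x≢𝟎 y≢𝟎 w≢𝟎 = refl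

  maskedR-zero : ∀ f → (∀ {x y w} → x ≢ 𝟎 → y ≢ 𝟎 → w ≢ 𝟎 → R K p x y w f ≈ 0#) → ∀ x y w → maskedR f x y w ≈ 0#
  maskedR-zero f Rf≈0 fzero    y        w        = refl
  maskedR-zero f Rf≈0 (fsuc _) fzero    w        = refl
  maskedR-zero f Rf≈0 (fsuc _) (fsuc _) fzero    = refl
  maskedR-zero f Rf≈0 (fsuc _) (fsuc _) (fsuc _) = Rf≈0 (λ ()) (λ ()) (λ ())

  combination : V → V → Carrier
  combination coef f = sum³ (λ x y w → coef x y w * maskedR f x y w)

  summand : V → V → V
  summand coef f x y w = if nonZero p x ∧ nonZero p y ∧ nonZero p w then coef x y w * R K p x y w f else 0#

  sumZp-combination : ∀ coef f →
    sumZp K p (λ x → sumZp K p (λ y → sumZp K p (summand coef f x y))) ≈ combination coef f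
  sumZp-combination coef f = begin
    sumZp K p (λ x → sumZp K p (λ y → sumZp K p (summand coef f x y)))
      ≈⟨ sumZp≈sum p (λ x → sumZp K p (λ y → sumZp K p (summand coef f x y))) ⟩
    sum (λ x → sumZp K p (λ y → sumZp K p (summand coef f x y)))
      ≈⟨ (sum-cong-≋ λ x → sumZp≈sum p (λ y → sumZp K p (summand coef f x y))) ⟩
    sum (λ x → sum (λ y → sumZp K p (summand coef f x y)))
      ≈⟨ (sum-cong-≋ λ x → sum-cong-≋ λ y → sumZp≈sum p (summand coef f x y)) ⟩
    sum³ (summand coef f)
      ≈⟨ (sum³-cong λ x y w → if-* (nonZero p x ∧ nonZero p y ∧ nonZero p w) (coef x y w) (R K p x y w f)) ⟩
    combination coef f ∎
    where
    if-* : ∀ b a r → (if b then a * r else 0#) ≈ a * (if b then r else 0#)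
    if-* true  a r = refl
    if-* false a r = sym (zeroʳ a)

  V⊆Ann : (Φ : Functional K p) → InV K p Φ → InAnn K p Φ
  V⊆Ann Φ (coef , Φ≈) g Wg g∈Wnc = begin
    φ Φ g Wg            ≈⟨ Φ≈ g Wg ⟩
    _                   ≈⟨ sumZp-combination coef g ⟩
    combination coef g  ≈⟨ (sum-zero _ λ x → sum-zero _ λ y → sum-zero _ λ w → trans
                             (*-congˡ (maskedR-zero g (λ {x} {y} {w} → R-vanishes-on-Wnc g g∈Wnc {x} {y} {w}) x y w)) (zeroʳ (coef x y w))) ⟩
    0#                  ∎

  vanishing-on-W : Subspace (c ⊔ ℓ)
  vanishing-on-W = record
    { member      = λ l → ∀ f → IsW K p f → fn l f ≈ 0#
    ; zero-member = λ f Wf → refl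
    ; resp-≈      = λ l≈m l∈ f Wf → trans (sym (l≈m f)) (l∈ f Wf)
    ; ⊞-closed    = λ l∈ m∈ f Wf → trans (+-cong (l∈ f Wf) (m∈ f Wf)) (+-identityˡ 0#)
    ; ⊡-closed    = λ a l∈ f Wf → trans (*-congˡ (l∈ f Wf)) (zeroʳ a)
    }

  combination-zero : ∀ f → combination (λ _ _ _ → 0#) f ≈ 0#
  combination-zero f = sum-zero _ λ x → sum-zero _ λ y → sum-zero _ λ w → zeroˡ (maskedR f x y w)

  combination-· : ∀ a coef f → combination (a ·v coef) f ≈ a * combination coef f
  combination-· a coef f = trans (sum³-cong λ x y w → *-assoc a (coef x y w) (maskedR f x y w))
    (sum³-· a (λ x y w → coef x y w * maskedR f x y w))

  -- Membership carries the coefficients, so the residue of the elimination delivers the witness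
  -- that `InV` asks for.
  spanned-on-W : Subspace (c ⊔ ℓ)
  spanned-on-W = record
    { member      = λ l → Σ V λ coef → ∀ f → IsW K p f → fn l f ≈ combination coef f
    ; zero-member = (λ _ _ _ → 0#) , λ f Wf → sym (combination-zero f)
    ; resp-≈      = λ { l≈m (coef , l≈) → coef , λ f Wf → trans (sym (l≈m f)) (l≈ f Wf) }
    ; ⊞-closed    = λ { (coef , l≈) (coef′ , m≈) → coef +v coef′ , λ f Wf →
        trans (+-cong (l≈ f Wf) (m≈ f Wf)) (trans
          (sym (sum³-+ (λ x y w → coef x y w * maskedR f x y w) (λ x y w → coef′ x y w * maskedR f x y w)))
          (sum³-cong λ x y w → sym (distribʳ (maskedR f x y w) (coef x y w) (coef′ x y w)))) }
    ; ⊡-closed    = λ { a (coef , l≈) → a ·v coef , λ f Wf →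
        trans (*-congˡ (l≈ f Wf)) (sym (combination-· a coef f)) }
    }

  private
    module E₀ = Elimination char0 vanishing-on-W
    module E₁ = Elimination char0 spanned-on-W

  -- Opaque because its normal form is an elimination over all p³ coordinates.
  abstract
    π₀ : E₀.Projection (IsW K p)
    π₀ = E₀.W-projection (λ l l-vanishes → l-vanishes)
  open E₀.Projection π₀ using () renaming
    (P to P₀; factor to c₀; factor≉0 to c₀≉0; P-into to P₀-into; P-residue to P₀-residue)

  -- Each coordinate is a form, and its residue under `P₀` vanishes on W.
  P₀-on-W : ∀ f → IsW K p f → apply P₀ f ≋ c₀ ·v f
  P₀-on-W f Wf x y w = x-y≈0⇒x≈y _ _ (trans (+-congˡ (-‿distribˡ-* c₀ (f x y w)))
    (P₀-residue (coordinate x y w) f Wf))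

  -- Its evaluation at f computes to `R`, so `kerR` can be handed to `∩kerR⊆Wnc` unchanged.
  R-expr : Zp p → Zp p → Zp p → Expr
  R-expr x y w = at 𝟏 x y ⊕ at 𝟏 y w ⊕ at 𝟏 w x ⊕ ⊖ at 𝟏 (_/F_ p y x) (_/F_ p w x)

  R-spanned : ∀ {x y w} → x ≢ 𝟎 → y ≢ 𝟎 → w ≢ 𝟎 → Subspace.member spanned-on-W ⟪ R-expr x y w ⟫
  R-spanned {x} {y} {w} x≢𝟎 y≢𝟎 w≢𝟎 = δ x y w , λ f Wf →
    sym (trans (sum³-δ x y w (maskedR f)) (maskedR-interior f x≢𝟎 y≢𝟎 w≢𝟎))

  kerR : V → Set ℓ
  kerR f = ∀ x y w → x ≢ 𝟎 → y ≢ 𝟎 → w ≢ 𝟎 → eval (R-expr x y w) f ≈ 0#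

  kerR-reducible : E₁.Reducible kerR
  kerR-reducible = E₁.reducible-∀ λ x → E₁.reducible-∀ λ y → E₁.reducible-∀ λ w →
    E₁.reducible-→ (¬? (x ≟ 𝟎)) λ x≢𝟎 → E₁.reducible-→ (¬? (y ≟ 𝟎)) λ y≢𝟎 → E₁.reducible-→ (¬? (w ≟ 𝟎)) λ w≢𝟎 →
      E₁.reducible-zero (R-expr x y w) (R-spanned x≢𝟎 y≢𝟎 w≢𝟎)

  abstract
    π₁ : E₁.Projection (λ f → IsW K p f × kerR f)
    -- A form vanishing on W agrees there with the combination whose coefficients are all zero, so
    -- the equations of W may be imposed in this elimination too.
    π₁ = kerR-reducible _ (E₁.W-projection λ l l-vanishes → (λ _ _ _ → 0#) , λ f Wf →
      trans (l-vanishes f Wf) (sym (combination-zero f)))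
  open E₁.Projection π₁ using () renaming
    (P to P₁; factor to c₁; factor≉0 to c₁≉0; P-into to P₁-into; P-residue to P₁-residue)

  module _ (Φ : Functional K p) where

    -- Φ is defined only on W, but `P₀` maps every function into W. The composite is a form on all
    -- of `V`, at the cost of the factor `c₀` on W.
    extension : Form
    extension = record
      { fn    = λ f → φ Φ (apply P₀ f) (P₀-into f)
      ; cong  = λ {f} {g} f≋g → φ-cong Φ _ _ (P₀-into f) (P₀-into g) λ x y w → cong (P₀ x y w) f≋g
      ; add   = λ f g →
          let eq = λ x y w → add (P₀ x y w) f g
              W+ = W-resp-≋ eq (P₀-into (f +v g))
          in trans (φ-cong Φ _ _ (P₀-into (f +v g)) W+ eq) (φ-add Φ _ _ (P₀-into f) (P₀-into g) W+)
      ; scale = λ a f →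
          let eq = λ x y w → scale (P₀ x y w) a f
              W· = W-resp-≋ eq (P₀-into (a ·v f))
          in trans (φ-cong Φ _ _ (P₀-into (a ·v f)) W· eq) (φ-scale Φ a _ (P₀-into f) W·)
      }

    extension-on-W : ∀ f (Wf : IsW K p f) → fn extension f ≈ c₀ * φ Φ f Wf
    extension-on-W f Wf = trans (φ-cong Φ _ _ (P₀-into f) W· (P₀-on-W f Wf)) (φ-scale Φ c₀ f Wf W·)
      where W· = W-resp-≋ (P₀-on-W f Wf) (P₀-into f)

    Ann⊆V : InAnn K p Φ → InV K p Φ
    Ann⊆V ann with P₁-residue extension | inverse (c₁ * c₀) (nonzero-* c₁≉0 c₀≉0)
    -- The residue of `extension` under `P₁` is a combination of the R's on W. Its first term
    -- vanishes by `extension-P₁`, so it equals -`c₁` `c₀` Φ there, and the factor `- u` undoes this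
    -- scalar.
    ... | coef , residue≈ | u , c₁c₀u≈1 = (- u) ·v coef , λ f Wf → begin
      φ Φ f Wf
        ≈⟨ trans (sym (*-identityˡ _)) (*-congʳ (sym c₁c₀u≈1)) ⟩
      c₁ * c₀ * u * φ Φ f Wf
        ≈⟨ solve 4 (λ c₁ c₀ u a → c₁ :* c₀ :* u :* a := (:- u) :* ((:- c₁) :* (c₀ :* a))) refl c₁ c₀ u (φ Φ f Wf) ⟩
      - u * (- c₁ * (c₀ * φ Φ f Wf))
        ≈⟨ *-congˡ (*-congˡ (extension-on-W f Wf)) ⟨
      - u * (- c₁ * fn extension f)
        ≈⟨ *-congˡ (trans (+-congʳ (extension-P₁ f)) (+-identityˡ _)) ⟨
      - u * (fn (extension ⊙ P₁) f + - c₁ * fn extension f)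
        ≈⟨ *-congˡ (residue≈ f Wf) ⟩
      - u * combination coef f
        ≈⟨ combination-· (- u) coef f ⟨
      combination ((- u) ·v coef) f
        ≈⟨ sumZp-combination ((- u) ·v coef) f ⟨
      _ ∎
      where
      -- `P₁` lands in W and in the kernel of every R, hence in Wⁿᶜ, which Φ annihilates.
      extension-P₁ : ∀ f → fn (extension ⊙ P₁) f ≈ 0#
      extension-P₁ f = begin
        fn extension (apply P₁ f)                       ≈⟨ extension-on-W (apply P₁ f) (proj₁ (P₁-into f)) ⟩
        c₀ * φ Φ (apply P₁ f) (proj₁ (P₁-into f))       ≈⟨ *-congˡ (ann _ _ (∩kerR⊆Wnc char0 _ (proj₁ (P₁-into f))
                                                             λ {x} {y} {w} → proj₂ (P₁-into f) x y w)) ⟩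
        c₀ * 0#                                         ≈⟨ zeroʳ c₀ ⟩
        0#                                              ∎

theorem3p4 : ∀ {c ℓ} (K : Field c ℓ) → CharZero K →
    (p : ℕ) (pp : Prime p) →
    (Φ : Functional K p {{prime⇒nonZero pp}}) →
    (InV K p {{prime⇒nonZero pp}} Φ → InAnn K p {{prime⇒nonZero pp}} Φ)
    × (InAnn K p {{prime⇒nonZero pp}} Φ → InV K p {{prime⇒nonZero pp}} Φ)
theorem3p4 K char0 zero          pp Φ = ⊥-elim (¬prime[0] pp)
theorem3p4 K char0 (suc zero)    pp Φ = ⊥-elim (¬prime[1] pp)
theorem3p4 K char0 (suc (suc k)) pp Φ = V⊆Ann Φ , Ann⊆V Φ
  where open Duality K char0 k pp
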